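{- The graph $G_d$ is (diamond, even hole)-free for all $d\ge 1$, and $G_d$ has no clique cutset for all $d\ge 2$.
   Context: Graphs are finite, simple and undirected. Construction of $G_d$ ($d\ge 1$). For $1\le k\le d$ let $S_k=\{(a_1,\dots,a_{k-1},a_k): a_1,\dots,a_{k-1}\in\{1,3\},\ a_k\in\{1,2,3,4\}\}$, and let $S^d=\bigcup_{k=1}^d S_k$. For $u\in S_k$ write $l(u)=k$ (the length of $u$). Order $S^d$ lexicographically: for $a=(a_1,\dots,a_k)$ and $b=(b_1,\dots,b_l)$, $a\preccurlyeq b$ if and only if either $k\le l$ and $a_i=b_i$ for $1\le i\le k$, or $t=\min\{i: a_i\ne b_i\}$ (over indices $i\le\min(k,l)$) is well-defined and $a_t<b_t$. This is a total order. Let $P'_d$ be the path on vertex set $S^d$ in which two vertices are adjacent exactly when they are consecutive in $\preccurlyeq$. Let $P_d$ be the path obtained from $P'_d$ by subdividing every edge $uv$ twice if $l(u)=l(v)$ and once otherwise. Let $W_d=\{v_1,\dots,v_d\}$ be a set of $d$ new vertices. $G_d$ is the graph on vertex set $W_d\cup V(P_d)$ whose edges are: the edges of $P_d$; all edges between distinct vertices of $W_d$; and, for each $1\le k\le d$, all edges from $v_k$ to the vertices of $S_k$. A hole is a chordless cycle of length at least four; it is even if it has an even number of vertices. A diamond is the complete graph on four vertices minus one edge. A graph is (diamond, even hole)-free if no induced subgraph of it is isomorphic to a diamond or to an even hole. For a connected graph $G$, a clique cutset is a clique $K\subseteq V(G)$ such that $G\setminus K$ is disconnected. -}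

module Defs where

open import Data.Bool using (if_then_else_)
open import Data.Empty using (⊥)
open import Data.Fin using (Fin; toℕ)
open import Data.Fin.Patterns using (0F; 1F)
open import Data.List using (List; [_]; _++_; map)
open import Data.List.Relation.Binary.Lex.Strict using (Lex-≤)
open import Data.Nat using (ℕ; zero; suc; _≤_; _<_; s≤s)
open import Data.Nat.Divisibility using (_∣_)
open import Data.Nat.Properties using (_≟_; 1+n≢n; ≤-trans; n≤1+n)
open import Data.Product using (Σ; Σ-syntax; ∃-syntax; _×_; _,_)
open import Data.Refinement using (Refinement; value)
open import Data.Sum using (_⊎_; inj₁; inj₂)
open import Data.Vec using (Vec; toList)
open import Function using (_∘_; _↔_; _⇔_; Inverse)
open import Level using (0ℓ)
open import Relation.Binary using (Rel; Symmetric; Irreflexive)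
open import Relation.Binary.Construct.Closure.ReflexiveTransitive using (Star)
open import Relation.Binary.Construct.Closure.Symmetric using (SymClosure; fwd; bwd; symmetric)
import Relation.Binary.Construct.NonStrictToStrict as ToStrict
open import Relation.Binary.PropositionalEquality using (_≡_; _≢_; refl; sym)
open import Relation.Nullary using (¬_; does)
open import Relation.Unary using (Pred; ∁)

-- Finiteness is not a field: it would exclude induced subgraphs on subsets
-- that are not known to be decidable.
record Graph : Set₁ where
  field
    Vertex : Set
    Adj    : Rel Vertex 0ℓ
    sym-Adj    : Symmetric Adj
    irrefl-Adj : Irreflexive _≡_ Adj

open Graph public using (Vertex; Adj)

infix 4 _≅_

record _≅_ (G H : Graph) : Set where
  field
    bijection : Vertex G ↔ Vertex H
    adjacency : ∀ u v →
      Adj G u v ⇔ Adj H (Inverse.to bijection u) (Inverse.to bijection v)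

-- Membership in X is irrelevant in a Refinement, so a vertex of G lying in X
-- gives exactly one vertex of induced G X, however many proofs of X v there are.
induced : (G : Graph) → Pred (Vertex G) 0ℓ → Graph
induced G X = record
  { Vertex     = Refinement (Vertex G) X
  ; Adj        = λ u v → Adj G (value u) (value v)
  ; sym-Adj    = Graph.sym-Adj G
  ; irrefl-Adj = λ { refl → Graph.irrefl-Adj G refl }
  }

infixl 8 _∖_

_∖_ : (G : Graph) → Pred (Vertex G) 0ℓ → Graph
G ∖ K = induced G (∁ K)

complete : ℕ → Graph
complete n = record
  { Vertex     = Fin n
  ; Adj        = _≢_
  ; sym-Adj    = λ u≢v → u≢v ∘ sym
  ; irrefl-Adj = λ u≡v u≢v → u≢v u≡v
  }

deleteEdge : (G : Graph) → Vertex G → Vertex G → Graph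
deleteEdge G a b = record
  { Vertex     = Vertex G
  ; Adj        = λ u v → Adj G u v × ¬ Deleted u v
  ; sym-Adj    = λ (u~v , kept) → Graph.sym-Adj G u~v , kept ∘ flip
  ; irrefl-Adj = λ u≡v (u~v , _) → Graph.irrefl-Adj G u≡v u~v
  }
  where
  Deleted : Rel (Vertex G) 0ℓ
  Deleted u v = (u ≡ a × v ≡ b) ⊎ (u ≡ b × v ≡ a)

  flip : ∀ {u v} → Deleted u v → Deleted v u
  flip (inj₁ (p , q)) = inj₂ (q , p)
  flip (inj₂ (p , q)) = inj₁ (q , p)

diamond : Graph
diamond = deleteEdge (complete 4) 0F 1F

data CycleArc {n : ℕ} (i j : Fin n) : Set where
  next : toℕ j ≡ suc (toℕ i) → CycleArc i j
  wrap : suc (toℕ i) ≡ n → toℕ j ≡ 0 → CycleArc i j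

cycle : (n : ℕ) → 3 ≤ n → Graph
cycle n 3≤n = record
  { Vertex     = Fin n
  ; Adj        = SymClosure CycleArc
  ; sym-Adj    = symmetric CycleArc
  ; irrefl-Adj = λ { refl (fwd a) → noLoop 3≤n a ; refl (bwd a) → noLoop 3≤n a }
  }
  where
  absurd : ∀ {m k} → 3 ≤ m → suc k ≡ m → k ≡ 0 → ⊥
  absurd (s≤s ()) refl refl

  noLoop : ∀ {m} {i : Fin m} → 3 ≤ m → CycleArc i i → ⊥
  noLoop _   (next p)   = 1+n≢n (sym p)
  noLoop 3≤m (wrap p q) = absurd 3≤m p q

IsEvenHole : Graph → Set
IsEvenHole H = ∃[ n ] Σ[ 4≤n ∈ 4 ≤ n ] 2 ∣ n × H ≅ cycle n (≤-trans (n≤1+n 3) 4≤n)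

DiamondEvenHoleFree : Graph → Set₁
DiamondEvenHoleFree G = (X : Pred (Vertex G) 0ℓ) →
  ¬ (induced G X ≅ diamond) × ¬ IsEvenHole (induced G X)

Connected : Graph → Set
Connected G = ∀ u v → Star (Adj G) u v

IsClique : (G : Graph) → Pred (Vertex G) 0ℓ → Set
IsClique G K = ∀ u v → K u → K v → u ≢ v → Adj G u v

-- The empty set counts as a clique; it is a cutset only if G itself is
-- disconnected, so it plays no role for connected G.
IsCliqueCutset : (G : Graph) → Pred (Vertex G) 0ℓ → Set
IsCliqueCutset G K = IsClique G K × ¬ Connected (G ∖ K)

HasCliqueCutset : Graph → Set₁
HasCliqueCutset G = Σ[ K ∈ Pred (Vertex G) 0ℓ ] IsCliqueCutset G K

data InnerLetter : Set where
  one three : InnerLetter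

data Letter : Set where
  one two three four : Letter

innerValue : InnerLetter → ℕ
innerValue one   = 1
innerValue three = 3

letterValue : Letter → ℕ
letterValue one   = 1
letterValue two   = 2
letterValue three = 3
letterValue four  = 4

-- S k is S_k for k ≥ 1.
S : ℕ → Set
S zero    = ⊥
S (suc n) = Vec InnerLetter n × Letter

-- The index i : Fin d stands for the length k = suc (toℕ i) with 1 ≤ k ≤ d,
-- both for words and for the vertices v_k below.
Word : ℕ → Set
Word d = Σ[ i ∈ Fin d ] S (suc (toℕ i))

module _ {d : ℕ} where

  wordLength : Word d → ℕ
  wordLength (i , _) = suc (toℕ i)

  entries : Word d → List ℕ
  entries (_ , as , a) = map innerValue (toList as) ++ [ letterValue a ]

  infix 4 _≼_ _≺_ _⋖_

  _≼_ : Rel (Word d) 0ℓ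
  u ≼ v = Lex-≤ _≡_ _<_ (entries u) (entries v)

  _≺_ : Rel (Word d) 0ℓ
  _≺_ = ToStrict._<_ _≡_ _≼_

  -- The edges of P'_d, each directed from its smaller to its larger end.
  _⋖_ : Rel (Word d) 0ℓ
  u ⋖ v = u ≺ v × (∀ w → ¬ (u ≺ w × w ≺ v))

  subdivisions : Word d → Word d → ℕ
  subdivisions u v = if does (wordLength u ≟ wordLength v) then 2 else 1

-- mid u v _ 0, mid u v _ 1, … are the vertices subdividing the edge uv, listed
-- from u to v. The proof that uv is an edge is irrelevant so that it does not
-- multiply the vertices.
data PathVertex (d : ℕ) : Set where
  word : Word d → PathVertex d
  mid  : (u v : Word d) → .(u ⋖ v) → Fin (subdivisions u v) → PathVertex d

data PathArc {d : ℕ} : Rel (PathVertex d) 0ℓ where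
  first : ∀ {u v i} .{e : u ⋖ v} → toℕ i ≡ 0 →
          PathArc (word u) (mid u v e i)
  step  : ∀ {u v i j} .{e : u ⋖ v} → toℕ j ≡ suc (toℕ i) →
          PathArc (mid u v e i) (mid u v e j)
  last  : ∀ {u v i} .{e : u ⋖ v} → suc (toℕ i) ≡ subdivisions u v →
          PathArc (mid u v e i) (word v)

data GVertex (d : ℕ) : Set where
  hub  : Fin d → GVertex d
  path : PathVertex d → GVertex d

data GArc {d : ℕ} : Rel (GVertex d) 0ℓ where
  path  : ∀ {x y} → PathArc x y → GArc (path x) (path y)
  hubs  : ∀ {i j} → i ≢ j → GArc (hub i) (hub j)
  spoke : ∀ {i} (a : S (suc (toℕ i))) → GArc (hub i) (path (word (i , a)))

G : ℕ → Graph
G d = record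
  { Vertex     = GVertex d
  ; Adj        = SymClosure GArc
  ; sym-Adj    = symmetric GArc
  ; irrefl-Adj = λ { refl (fwd a) → noLoop a ; refl (bwd a) → noLoop a }
  }
  where
  noLoop : ∀ {x : GVertex d} → GArc x x → ⊥
  noLoop (path (step p)) = 1+n≢n (sym p)
  noLoop (hubs i≢i)      = i≢i refl

{-# OPTIONS --safe #-}
module Submission where

-- Colour a word by the parity of its last letter. If no word of S_k ∪ S_l lies
-- strictly between u ∈ S_k and v ∈ S_l, then u and v have different colours when
-- k = l and equal colours when k ≠ l. For consecutive words this says that the
-- colouring extends to a proper 2-colouring of the subdivided path, so triangles
-- consist of hubs only. A hole consists of a subpath and either one hub, where
-- the ends of the subpath have different colours, or two adjacent hubs, where
-- they have the same colour; in both cases its length is odd.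
-- A clique that meets the path in a vertex takes from it one vertex or two
-- adjacent ones, and some surviving hub has neighbours on each side that is left.

open import Defs
open import Data.Bool using (Bool; true; false; not; if_then_else_)
import Data.Bool.Properties as Bool
open import Data.Empty using (⊥; ⊥-elim; ⊥-elim-irr)
open import Data.Fin using (Fin; toℕ; fromℕ<) renaming (suc to fsuc)
open import Data.Fin.Patterns using (0F; 1F; 2F; 3F)
import Data.Fin.Properties as Fin
open import Data.Irrelevant using () renaming ([_] to irr)
open import Data.List using (List; []; _∷_; [_]; _++_; map; length)
open import Data.List.Properties using (∷-injectiveˡ; ∷-injectiveʳ)
open import Data.List.Relation.Binary.Lex.Strict
  using (Lex-<; Lex-≤; base; halt; this; next; <-compare)
open import Data.List.Relation.Binary.Pointwise using (Pointwise-≡⇒≡)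
open import Data.List.Relation.Unary.All using (All; []; _∷_)
open import Data.Nat
  using (ℕ; zero; suc; _+_; _*_; _^_; _≤_; _<_; z≤n; s≤s; z<s; s<s)
open import Data.Nat.Divisibility using (divides)
open import Data.Nat.DivMod
open import Data.Nat.Properties
open import Data.Product using (Σ-syntax; ∃; ∃-syntax; _×_; _,_; proj₁; proj₂)
open import Data.Refinement using (Refinement; value; _,_)
open import Data.Sum using (_⊎_; inj₁; inj₂; swap; [_,_]′)
open import Data.Vec using (Vec; []; _∷_; toList; replicate)
open import Function using (_∘_; Inverse; Equivalence)
open import Relation.Binary using (Rel; tri<; tri≈; tri>)
open import Relation.Binary.Construct.Closure.ReflexiveTransitive as Star using (Star; ε; _◅_; _◅◅_)
open import Relation.Binary.Construct.Closure.Symmetric using (SymClosure; fwd; bwd; symmetric)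
open import Relation.Binary.PropositionalEquality
  using (_≡_; _≢_; refl; sym; trans; cong; subst; subst₂; ≢-sym)
open import Relation.Nullary using (¬_; Dec; yes; no; contradiction; recompute)
open import Relation.Nullary.Decidable
  using (dec-true; dec-false; map′; _⊎-dec_; _×-dec_; ¬¬-excluded-middle)
open import Relation.Unary using (Decidable)

-- Only the odd letters 1 and 3 can be continued. So all proper extensions of a word lie between
-- that word, which then ends in an odd letter, and its next sibling, which ends in the following
-- even letter. This is what ties the order to the parity. The ends of the subpath in a hole need
-- not be consecutive words: words of other levels may lie between them. The colour rule is
-- therefore stated for the relation `Unseparated`, which looks only at words on the levels of its
-- two arguments and covers both consecutive words and the ends of such a subpath. Order is handled
-- through numbers: `rank` embeds the words in ℕ and `pos` embeds the path vertices. A walk in the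
-- path then cannot pass a word without visiting it, and inequalities drawn from irrelevant edge
-- proofs can be recomputed because they are decidable.

infix 4 _<ₗ_

_<ₗ_ : List ℕ → List ℕ → Set
_<ₗ_ = Lex-< _≡_ _<_

-- Lexicographic comparison of words

encode : ∀ {n} → Vec InnerLetter n → Letter → List ℕ
encode as a = map innerValue (toList as) ++ [ letterValue a ]

inner : InnerLetter → Letter
inner one   = one
inner three = three

innerSucc : InnerLetter → Letter
innerSucc one   = two
innerSucc three = four

encode-last-< : ∀ {n} (p : Vec InnerLetter n) a b →
                letterValue a < letterValue b → encode p a <ₗ encode p b
encode-last-< []      _ _ a<b = this a<b
encode-last-< (_ ∷ p) a b a<b = next refl (encode-last-< p a b a<b)

-- The comparison is settled either at the last letter or strictly before it. In the second case
-- both last letters can be replaced freely, which produces witnesses between two words.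
same-length-< : ∀ {n} (p q : Vec InnerLetter n) {a b} → encode p a <ₗ encode q b →
                (p ≡ q × letterValue a < letterValue b) ⊎
                (∀ a′ b′ → encode p a′ <ₗ encode q b′)
same-length-< []      []      (this a<b)         = inj₁ (refl , a<b)
same-length-< []      []      (next _ (base ()))
same-length-< (_ ∷ p) (_ ∷ q) (this c<d)         = inj₂ λ _ _ → this c<d
same-length-< (one ∷ p) (one ∷ q) (next _ p<q) with same-length-< p q p<q
... | inj₁ (refl , a<b) = inj₁ (refl , a<b)
... | inj₂ rest         = inj₂ λ a b → next refl (rest a b)
same-length-< (three ∷ p) (three ∷ q) (next _ p<q) with same-length-< p q p<q
... | inj₁ (refl , a<b) = inj₁ (refl , a<b)
... | inj₂ rest         = inj₂ λ a b → next refl (rest a b)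

-- The shorter word is compared with inner letters of the longer one only, so the last letter of the
-- longer word is never reached.
shorter-<-any-last : ∀ {m n} (p : Vec InnerLetter m) (q : Vec InnerLetter n) {a b} → m < n →
                     encode p a <ₗ encode q b → ∀ b′ → encode p a <ₗ encode q b′
shorter-<-any-last []      (_ ∷ _)       _         (this a<c)    _ = this a<c
shorter-<-any-last []      (_ ∷ [])      _         (next a≡c _)  _ = next a≡c halt
shorter-<-any-last []      (_ ∷ _ ∷ _)   _         (next a≡c _)  _ = next a≡c halt
shorter-<-any-last (_ ∷ _) (_ ∷ _)       _         (this c<d)    _ = this c<d
shorter-<-any-last (_ ∷ p) (_ ∷ q)       (s<s m<n) (next c≡d lt) b =
  next c≡d (shorter-<-any-last p q m<n lt b)

longer-<-any-last : ∀ {m n} (p : Vec InnerLetter m) (q : Vec InnerLetter n) {a b} → m < n →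
                    encode q b <ₗ encode p a → ∀ b′ → encode q b′ <ₗ encode p a
longer-<-any-last []      (_ ∷ _)     _         (this c<a)    _ = this c<a
longer-<-any-last []      (_ ∷ [])    _         (next _ ())   _
longer-<-any-last []      (_ ∷ _ ∷ _) _         (next _ ())   _
longer-<-any-last (_ ∷ _) (_ ∷ _)     _         (this d<c)    _ = this d<c
longer-<-any-last (_ ∷ p) (_ ∷ q)     (s<s m<n) (next d≡c lt) b =
  next d≡c (longer-<-any-last p q m<n lt b)

-- Together with `pivot` this is the ancestor of length `suc m` of a word with inner letters `q`; it
-- comes in two pieces because the last letter of a word has a type of its own.
prefix : ∀ {m n} → m < n → Vec InnerLetter n → Vec InnerLetter m
prefix {zero}  _         _       = []
prefix {suc _} (s<s m<n) (c ∷ q) = c ∷ prefix m<n q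

pivot : ∀ {m n} → m < n → Vec InnerLetter n → InnerLetter
pivot {zero}  _         (c ∷ _) = c
pivot {suc _} (s<s m<n) (_ ∷ q) = pivot m<n q

[]<encode : ∀ {n} (p : Vec InnerLetter n) {a} → [] <ₗ encode p a
[]<encode []      = halt
[]<encode (_ ∷ _) = halt

inner-value : ∀ c → letterValue (inner c) ≡ innerValue c
inner-value one   = refl
inner-value three = refl

innerSucc-value : ∀ c → letterValue (innerSucc c) ≡ suc (innerValue c)
innerSucc-value one   = refl
innerSucc-value three = refl

letterValue-injective : ∀ {a b} → letterValue a ≡ letterValue b → a ≡ b
letterValue-injective {one}   {one}   _ = refl
letterValue-injective {two}   {two}   _ = refl
letterValue-injective {three} {three} _ = refl
letterValue-injective {four}  {four}  _ = refl

innerValue-injective : ∀ {a b} → innerValue a ≡ innerValue b → a ≡ b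
innerValue-injective {one}   {one}   _ = refl
innerValue-injective {three} {three} _ = refl

prefix-< : ∀ {m n} (m<n : m < n) (q : Vec InnerLetter n) {b} →
           encode (prefix m<n q) (inner (pivot m<n q)) <ₗ encode q b
prefix-< {zero}  m<n       (c ∷ q) = next (inner-value c) ([]<encode q)
prefix-< {suc _} (s<s m<n) (c ∷ q) = next refl (prefix-< m<n q)

prefix-> : ∀ {m n} (m<n : m < n) (q : Vec InnerLetter n) {b} →
           encode q b <ₗ encode (prefix m<n q) (innerSucc (pivot m<n q))
prefix-> {zero}  m<n       (c ∷ q) = this (≤-reflexive (sym (innerSucc-value c)))
prefix-> {suc _} (s<s m<n) (c ∷ q) = next refl (prefix-> m<n q)

-- Among the words of its length, the ancestor of `encode q b` is the last one before it, because
-- the two agree up to the end of the ancestor. In the case of equality only the last letter is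
-- kept, since it determines the colour.
<-prefix : ∀ {m n} (m<n : m < n) (p : Vec InnerLetter m) (q : Vec InnerLetter n) {a b} →
             encode p a <ₗ encode q b →
             (encode p a <ₗ encode (prefix m<n q) (inner (pivot m<n q))) ⊎ (a ≡ inner (pivot m<n q))
<-prefix m<n [] (c ∷ q) (this a<c)   = inj₁ (this (subst (_ <_) (sym (inner-value c)) a<c))
<-prefix m<n [] (c ∷ q) (next a≡c _) =
  inj₂ (letterValue-injective (trans a≡c (sym (inner-value c))))
<-prefix (s<s m<n) (_ ∷ p) (_ ∷ q) (this c<d) = inj₁ (this c<d)
<-prefix (s<s m<n) (_ ∷ p) (_ ∷ q) (next c≡d lt) with <-prefix m<n p q lt
... | inj₁ lt′ = inj₁ (next c≡d lt′)
... | inj₂ eq  = inj₂ eq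

-- A shorter word above `encode q b` exceeds it at one of the first `suc m` letters. The least way
-- to do so is to raise the pivot by one, which gives a letter because the pivot is 1 or 3.
prefix-least : ∀ {m n} (m<n : m < n) (p : Vec InnerLetter m) (q : Vec InnerLetter n) {a b} →
                 encode q b <ₗ encode p a →
                 (encode (prefix m<n q) (innerSucc (pivot m<n q)) <ₗ encode p a) ⊎
                 (a ≡ innerSucc (pivot m<n q))
prefix-least m<n [] (c ∷ q) {a} (this c<a) with m≤n⇒m<n∨m≡n c<a
... | inj₁ c+1<a = inj₁ (this (subst (_< letterValue a) (sym (innerSucc-value c)) c+1<a))
... | inj₂ c+1≡a = inj₂ (letterValue-injective (trans (sym c+1≡a) (sym (innerSucc-value c))))
prefix-least m<n [] (_ ∷ [])    (next _ ())
prefix-least m<n [] (_ ∷ _ ∷ _) (next _ ())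
prefix-least (s<s m<n) (_ ∷ p) (_ ∷ q) (this d<c) = inj₁ (this d<c)
prefix-least (s<s m<n) (_ ∷ p) (_ ∷ q) (next d≡c lt) with prefix-least m<n p q lt
... | inj₁ lt′ = inj₁ (next d≡c lt′)
... | inj₂ eq  = inj₂ eq

-- Numerical ranks of words

-- Base 5 digits padded with zeros: since the letters are nonzero, a proper
-- prefix gets a smaller value than the longer word.
value₅ : ℕ → List ℕ → ℕ
value₅ zero    _        = 0
value₅ (suc d) []       = 0
value₅ (suc d) (a ∷ as) = a * 5 ^ d + value₅ d as

IsDigit : ℕ → Set
IsDigit a = 0 < a × a < 5

value₅-bound : ∀ d {as} → All IsDigit as → value₅ d as < 5 ^ d
value₅-bound zero    _  = z<s
value₅-bound (suc d) [] = m^n>0 5 (suc d)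
value₅-bound (suc d) {a ∷ as} ((_ , a<5) ∷ as-ok) = begin-strict
  a * 5 ^ d + value₅ d as <⟨ +-monoʳ-< (a * 5 ^ d) (value₅-bound d as-ok) ⟩
  a * 5 ^ d + 5 ^ d       ≡⟨ +-comm (a * 5 ^ d) (5 ^ d) ⟩
  suc a * 5 ^ d           ≤⟨ *-monoˡ-≤ (5 ^ d) a<5 ⟩
  5 ^ suc d               ∎
  where open ≤-Reasoning

-- The deciding letter of `ys` must be among the first `d`, hence the bound on the length. Later
-- digits of `xs` cannot make up for it, as together they are worth less than one unit of the
-- deciding digit.
value₅-mono : ∀ d {xs ys} → All IsDigit xs → All IsDigit ys → length ys ≤ d →
              xs <ₗ ys → value₅ d xs < value₅ d ys
value₅-mono d _ _ _ (base ())
value₅-mono (suc d) {ys = y ∷ ys} _ ((0<y , _) ∷ _) _ halt =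
  <-≤-trans (*-mono-< {0} {y} {0} {5 ^ d} 0<y (m^n>0 5 d)) (m≤m+n (y * 5 ^ d) (value₅ d ys))
value₅-mono (suc d) {x ∷ xs} {y ∷ ys} (_ ∷ xs-ok) _ _ (this x<y) = begin-strict
  x * 5 ^ d + value₅ d xs <⟨ +-monoʳ-< (x * 5 ^ d) (value₅-bound d xs-ok) ⟩
  x * 5 ^ d + 5 ^ d       ≡⟨ +-comm (x * 5 ^ d) (5 ^ d) ⟩
  suc x * 5 ^ d           ≤⟨ *-monoˡ-≤ (5 ^ d) x<y ⟩
  y * 5 ^ d               ≤⟨ m≤m+n (y * 5 ^ d) (value₅ d ys) ⟩
  y * 5 ^ d + value₅ d ys ∎
  where open ≤-Reasoning
value₅-mono (suc d) {x ∷ _} (_ ∷ xs-ok) (_ ∷ ys-ok) (s≤s len) (next refl lt) =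
  +-monoʳ-< (x * 5 ^ d) (value₅-mono d xs-ok ys-ok len lt)

letter-digit : ∀ a → IsDigit (letterValue a)
letter-digit one   = z<s , s<s z<s
letter-digit two   = z<s , s<s (s<s z<s)
letter-digit three = z<s , s<s (s<s (s<s z<s))
letter-digit four  = z<s , s<s (s<s (s<s (s<s z<s)))

encode-digits : ∀ {n} (p : Vec InnerLetter n) a → All IsDigit (encode p a)
encode-digits []      a = letter-digit a ∷ []
encode-digits (c ∷ p) a = subst IsDigit (inner-value c) (letter-digit (inner c)) ∷ encode-digits p a

length-encode : ∀ {n} (p : Vec InnerLetter n) a → length (encode p a) ≡ suc n
length-encode []      a = refl
length-encode (_ ∷ p) a = cong suc (length-encode p a)

encode-injective : ∀ {n} (p q : Vec InnerLetter n) {a b} → encode p a ≡ encode q b → p ≡ q × a ≡ b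
encode-injective []      []      eq = refl , letterValue-injective (∷-injectiveˡ eq)
encode-injective (c ∷ p) (d ∷ q) eq
  with refl ← innerValue-injective {c} {d} (∷-injectiveˡ eq)
     | refl , refl ← encode-injective p q (∷-injectiveʳ eq) = refl , refl

-- Colours of words with no separating word

odd : Letter → Bool
odd one   = true
odd two   = false
odd three = true
odd four  = false

module _ {d : ℕ} where

  level : Word d → Fin d
  level = proj₁

  colour : Word d → Bool
  colour (_ , _ , a) = odd a

  rank : Word d → ℕ
  rank u = value₅ d (entries u)

  entries-injective : ∀ {u v : Word d} → entries u ≡ entries v → u ≡ v
  entries-injective {i , p , a} {j , q , b} eq
    with refl ← Fin.toℕ-injective {i = i} {j} (suc-injective
           (trans (sym (length-encode p a)) (trans (cong length eq) (length-encode q b))))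
    with refl , refl ← encode-injective p q eq = refl

  rank-mono : ∀ (u v : Word d) → entries u <ₗ entries v → rank u < rank v
  rank-mono (_ , p , a) (i , q , b) = value₅-mono d (encode-digits p a) (encode-digits q b)
    (subst (_≤ d) (sym (length-encode q b)) (Fin.toℕ<n i))

  rank-reflects : ∀ {u v : Word d} → rank u < rank v → entries u <ₗ entries v
  rank-reflects {u} {v} ru<rv with <-compare sym <-cmp (entries u) (entries v)
  ... | tri< u<v _ _ = u<v
  ... | tri≈ _ u≈v _ = contradiction ru<rv (<-irrefl (cong (value₅ d) (Pointwise-≡⇒≡ u≈v)))
  ... | tri> _ _ v<u = contradiction (rank-mono v u v<u) (<-asym ru<rv)

  rank-injective : ∀ {u v : Word d} → rank u ≡ rank v → u ≡ v
  rank-injective {u} {v} eq with <-compare sym <-cmp (entries u) (entries v)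
  ... | tri< u<v _ _ = contradiction (rank-mono u v u<v) (<-irrefl eq)
  ... | tri≈ _ u≈v _ = entries-injective (Pointwise-≡⇒≡ u≈v)
  ... | tri> _ _ v<u = contradiction (rank-mono v u v<u) (<-irrefl (sym eq))

  private
    strict⊎equal : ∀ {xs ys : List ℕ} → Lex-≤ _≡_ _<_ xs ys → (xs <ₗ ys) ⊎ (xs ≡ ys)
    strict⊎equal (base _)       = inj₂ refl
    strict⊎equal halt           = inj₁ halt
    strict⊎equal (this x<y)     = inj₁ (this x<y)
    strict⊎equal (next refl le) with strict⊎equal le
    ... | inj₁ lt   = inj₁ (next refl lt)
    ... | inj₂ refl = inj₂ refl

    weaken : ∀ {xs ys : List ℕ} → xs <ₗ ys → Lex-≤ _≡_ _<_ xs ys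
    weaken (base ())
    weaken halt          = halt
    weaken (this x<y)    = this x<y
    weaken (next x≡y lt) = next x≡y (weaken lt)

  ≺⇒rank< : ∀ {u v : Word d} → u ≺ v → rank u < rank v
  ≺⇒rank< {u} {v} (u≼v , u≢v) with strict⊎equal u≼v
  ... | inj₁ u<v = rank-mono u v u<v
  ... | inj₂ eq  = contradiction (entries-injective eq) u≢v

  rank<⇒≺ : ∀ {u v : Word d} → rank u < rank v → u ≺ v
  rank<⇒≺ {u} {v} ru<rv = weaken (rank-reflects {u} {v} ru<rv) , λ { refl → <-irrefl refl ru<rv }

  ⋖⇒rank< : ∀ {u v : Word d} → u ⋖ v → rank u < rank v
  ⋖⇒rank< (u≺v , _) = ≺⇒rank< u≺v

  ⋖-covers : ∀ {u v : Word d} → u ⋖ v → ∀ w → rank u < rank w → rank v ≤ rank w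
  ⋖-covers (_ , none) w ru<rw = ≮⇒≥ λ rw<rv → none w (rank<⇒≺ ru<rw , rank<⇒≺ rw<rv)

  -- Words of other levels do not count, because a hub sees only the words of its own level.
  Separates : Word d → Word d → Word d → Set
  Separates u v w = (level w ≡ level u ⊎ level w ≡ level v) × rank u < rank w × rank w < rank v

  private
    letters-alternate : ∀ a b → letterValue a < letterValue b →
      (∀ c → ¬ (letterValue a < letterValue c × letterValue c < letterValue b)) → odd a ≢ odd b
    letters-alternate one three _ none _ = none two (s<s z<s , s<s (s<s z<s))
    letters-alternate two four  _ none _ = none three (s<s (s<s z<s) , s<s (s<s (s<s z<s)))
    letters-alternate one two   _ _ ()
    letters-alternate one four  _ _ ()
    letters-alternate two three _ _ ()
    letters-alternate three four _ _ ()
    letters-alternate one one (s<s ())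
    letters-alternate three one (s<s ())
    letters-alternate two two (s<s (s<s ()))
    letters-alternate three three (s<s (s<s (s<s ())))
    letters-alternate four two (s<s (s<s ()))
    letters-alternate four four (s<s (s<s (s<s (s<s ()))))

    <four : ∀ a → a ≡ four ⊎ letterValue a < 4
    <four one   = inj₂ (s<s z<s)
    <four two   = inj₂ (s<s (s<s z<s))
    <four three = inj₂ (s<s (s<s (s<s z<s)))
    <four four  = inj₁ refl

    >one : ∀ a → a ≡ one ⊎ 1 < letterValue a
    >one one   = inj₁ refl
    >one two   = inj₂ (s<s z<s)
    >one three = inj₂ (s<s z<s)
    >one four  = inj₂ (s<s z<s)

    odd-inner : ∀ c → odd (inner c) ≡ true
    odd-inner one   = refl
    odd-inner three = refl

    even-innerSucc : ∀ c → odd (innerSucc c) ≡ false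
    even-innerSucc one   = refl
    even-innerSucc three = refl

  -- Under a common prefix the last letters are neighbours in 1, 2, 3, 4. Under different prefixes
  -- `u` must end in 4 and `v` in 1, since otherwise changing the last letter of `u` to 4, or that
  -- of `v` to 1, would give a separating word.
  consecutive-same-level : ∀ (u v : Word d) → rank u < rank v → (∀ w → ¬ Separates u v w) →
                           level u ≡ level v → colour u ≢ colour v
  consecutive-same-level u@(i , p , a) v@(i , q , b) u<v none refl
    with same-length-< p q {a} {b} (rank-reflects {u} {v} u<v)
  ... | inj₁ (refl , a<b) = letters-alternate a b a<b λ c (a<c , c<b) →
        let w = i , p , c in
        none w (inj₁ refl , rank-mono u w (encode-last-< p a c a<c)
                          , rank-mono w v (encode-last-< p c b c<b))
  ... | inj₂ all< with <four a | >one b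
  ...   | inj₂ a<4  | _         = let w = i , p , four in λ _ → none w
          (inj₁ refl , rank-mono u w (encode-last-< p a four a<4) , rank-mono w v (all< four b))
  ...   | inj₁ _    | inj₂ 1<b  = let w = i , q , one in λ _ → none w
          (inj₁ refl , rank-mono u w (all< a one) , rank-mono w v (encode-last-< q one b 1<b))
  ...   | inj₁ refl | inj₁ refl = λ ()

  -- The longer word ends in 1 if it is the larger one and in 4 otherwise; the
  -- shorter word is the prefix of the longer one, respectively the next word
  -- after that prefix with the same parent.
  consecutive-distinct-levels : ∀ (u v : Word d) → rank u < rank v → (∀ w → ¬ Separates u v w) →
                                level u ≢ level v → colour u ≡ colour v
  consecutive-distinct-levels u@(i , p , a) v@(j , q , b) u<v none i≢j
    with lt ← rank-reflects {u} {v} u<v | <-cmp (toℕ i) (toℕ j)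
  ... | tri≈ _ i≡j _ = contradiction (Fin.toℕ-injective i≡j) i≢j
  ... | tri< i<j _ _ with >one b | <-prefix i<j p q {a} {b} lt
  ...   | inj₂ 1<b  | _         = let w = j , q , one in contradiction
          (inj₂ refl , rank-mono u w (shorter-<-any-last p q {a} {b} i<j lt one)
                     , rank-mono w v (encode-last-< q one b 1<b)) (none w)
  ...   | inj₁ refl | inj₁ u<t  = let w = i , prefix i<j q , inner (pivot i<j q) in contradiction
          (inj₁ refl , rank-mono u w u<t , rank-mono w v (prefix-< i<j q {b})) (none w)
  ...   | inj₁ refl | inj₂ refl = odd-inner (pivot i<j q)
  consecutive-distinct-levels u@(i , p , a) v@(j , q , b) u<v none i≢j
      | tri> _ _ j<i with <four a | prefix-least j<i q p {b} {a} lt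
  ...   | inj₂ a<4  | _         = let w = i , p , four in contradiction
          (inj₁ refl , rank-mono u w (encode-last-< p a four a<4)
                     , rank-mono w v (longer-<-any-last q p {b} {a} j<i lt four)) (none w)
  ...   | inj₁ refl | inj₁ t<v  = let w = j , prefix j<i p , innerSucc (pivot j<i p) in contradiction
          (inj₂ refl , rank-mono u w (prefix-> j<i p {a}) , rank-mono w v t<v) (none w)
  ...   | inj₁ refl | inj₂ refl = sym (even-innerSucc (pivot j<i p))

-- The 2-colouring of the subdivided path

alternate : ℕ → Bool → Bool
alternate zero    b = b
alternate (suc n) b = not (alternate n b)

≢⇒≡not : ∀ {a b : Bool} → a ≢ b → b ≡ not a
≢⇒≡not {true}  {true}  a≢b = contradiction refl a≢b
≢⇒≡not {true}  {false} _   = refl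
≢⇒≡not {false} {true}  _   = refl
≢⇒≡not {false} {false} a≢b = contradiction refl a≢b

module _ {d : ℕ} where

  -- Made symmetric in `u` and `v` because a hole may run through its subpath in either direction.
  Unseparated : Word d → Word d → Set
  Unseparated u v = ∀ w → (level w ≡ level u ⊎ level w ≡ level v) → w ≢ u → w ≢ v →
                    (rank u < rank w → rank v < rank w) × (rank v < rank w → rank u < rank w)

  rank-separates : ∀ {u v : Word d} → rank u ≢ rank v → u ≢ v
  rank-separates ru≢rv refl = ru≢rv refl

  private
    none-between : ∀ {u v} → Unseparated u v → ∀ w → ¬ Separates u v w
    none-between unsep w (lvl , u<w , w<v) =
      <-asym w<v (proj₁ (unsep w lvl (rank-separates (>⇒≢ u<w)) (rank-separates (<⇒≢ w<v))) u<w)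

  Unseparated-sym : ∀ {u v} → Unseparated u v → Unseparated v u
  Unseparated-sym unsep w lvl w≢v w≢u =
    let below , above = unsep w (swap lvl) w≢u w≢v in above , below

  unseparated-same-level : ∀ {u v : Word d} → u ≢ v → Unseparated u v →
                           level u ≡ level v → colour u ≢ colour v
  unseparated-same-level {u} {v} u≢v unsep lvl with <-cmp (rank u) (rank v)
  ... | tri< u<v _ _ = consecutive-same-level u v u<v (none-between unsep) lvl
  ... | tri≈ _ u≡v _ = contradiction (rank-injective u≡v) u≢v
  ... | tri> _ _ v<u =
    ≢-sym (consecutive-same-level v u v<u (none-between (Unseparated-sym unsep)) (sym lvl))

  unseparated-distinct-levels : ∀ {u v : Word d} → Unseparated u v →
                                level u ≢ level v → colour u ≡ colour v
  unseparated-distinct-levels {u} {v} unsep lvl with <-cmp (rank u) (rank v)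
  ... | tri< u<v _ _ = consecutive-distinct-levels u v u<v (none-between unsep) lvl
  ... | tri≈ _ u≡v _ = contradiction (cong level (rank-injective u≡v)) lvl
  ... | tri> _ _ v<u =
    sym (consecutive-distinct-levels v u v<u (none-between (Unseparated-sym unsep)) (≢-sym lvl))

  ⋖⇒Unseparated : ∀ {u v : Word d} → u ⋖ v → Unseparated u v
  ⋖⇒Unseparated u⋖v w _ _ w≢v =
    (λ u<w → ≤∧≢⇒< (⋖-covers u⋖v w u<w) (λ eq → w≢v (rank-injective (sym eq)))) ,
    <-trans (⋖⇒rank< u⋖v)

  ⋖-unique-target : ∀ {u v v′ : Word d} → .(u ⋖ v) → .(u ⋖ v′) → v ≡ v′
  ⋖-unique-target {u} {v} {v′} e e′ = rank-injective (≤-antisym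
    (recompute (_ ≤? _) (⋖-covers e v′ (⋖⇒rank< e′)))
    (recompute (_ ≤? _) (⋖-covers e′ v (⋖⇒rank< e))))

  subdivisions-same-level : ∀ {u v : Word d} → level u ≡ level v → subdivisions u v ≡ 2
  subdivisions-same-level {u} {v} lvl = cong (if_then 2 else 1)
    (dec-true (wordLength u ≟ wordLength v) (cong (suc ∘ toℕ) lvl))

  subdivisions-distinct-levels : ∀ {u v : Word d} → level u ≢ level v → subdivisions u v ≡ 1
  subdivisions-distinct-levels {u} {v} lvl = cong (if_then 2 else 1)
    (dec-false (wordLength u ≟ wordLength v) (lvl ∘ Fin.toℕ-injective ∘ suc-injective))

  subdivisions-bounds : ∀ u v → 0 < subdivisions {d} u v × subdivisions u v ≤ 2
  subdivisions-bounds u v with level u Fin.≟ level v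
  ... | yes lvl rewrite subdivisions-same-level {u} {v} lvl     = z<s , ≤-refl
  ... | no  lvl rewrite subdivisions-distinct-levels {u} {v} lvl = z<s , s≤s z≤n

  -- An edge subdivided `n` times becomes `suc n` edges: three between words of equal length, whose
  -- colours differ, and two otherwise, where the colours agree.
  edge-colour : ∀ {u v : Word d} → .(u ⋖ v) → colour v ≡ alternate (suc (subdivisions u v)) (colour u)
  edge-colour {u} {v} e = recompute (_ Bool.≟ _) (relevant e)
    where
    relevant : u ⋖ v → colour v ≡ alternate (suc (subdivisions u v)) (colour u)
    relevant u⋖v with level u Fin.≟ level v
    ... | yes lvl rewrite subdivisions-same-level {u} {v} lvl =
      trans (≢⇒≡not (unseparated-same-level (rank-separates (<⇒≢ (⋖⇒rank< u⋖v))) (⋖⇒Unseparated u⋖v) lvl))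
            (sym (Bool.not-involutive _))
    ... | no lvl rewrite subdivisions-distinct-levels {u} {v} lvl =
      trans (sym (unseparated-distinct-levels (⋖⇒Unseparated u⋖v) lvl)) (sym (Bool.not-involutive _))

  pathColour : PathVertex d → Bool
  pathColour (word u)      = colour u
  pathColour (mid u v e i) = alternate (suc (toℕ i)) (colour u)

  PathAdj : PathVertex d → PathVertex d → Set
  PathAdj = SymClosure PathArc

  arc-colour : ∀ {x y} → PathArc x y → pathColour y ≡ not (pathColour x)
  arc-colour (first {u} {v} {i} i≡0)          rewrite i≡0 = refl
  arc-colour (step j≡1+i)        rewrite j≡1+i = refl
  arc-colour (last {u} {v} {i} {e} 1+i≡n) =
    trans (edge-colour e) (cong (λ n → alternate (suc n) (colour u)) (sym 1+i≡n))

  adjacent-colour : ∀ {x y} → PathAdj x y → pathColour y ≡ not (pathColour x)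
  adjacent-colour (fwd xy) = arc-colour xy
  adjacent-colour (bwd yx) = trans (sym (Bool.not-involutive _)) (cong not (sym (arc-colour yx)))

  -- Each word owns a block of three positions, for itself and for the at most two subdividing
  -- vertices after it. Neighbours on the path need not get consecutive numbers; only the order
  -- matters.
  pos : PathVertex d → ℕ
  pos (word u)      = rank u * 3
  pos (mid u v e i) = suc (toℕ i) + rank u * 3

  offset<3 : ∀ (u v : Word d) (i : Fin (subdivisions u v)) → suc (toℕ i) < 3
  offset<3 u v i = s<s (<-≤-trans (Fin.toℕ<n i) (proj₂ (subdivisions-bounds u v)))

  block-≤ : ∀ {b m n} → b < 3 → m * 3 ≤ b + n * 3 → m ≤ n
  block-≤ {b} {m} {n} b<3 le = ≮⇒≥ λ n<m →
    <⇒≱ (<-≤-trans (+-monoˡ-< (n * 3) b<3) (*-monoˡ-≤ 3 n<m)) le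

  arc-pos-< : ∀ {x y} → PathArc x y → pos x < pos y
  arc-pos-< (first i≡0) rewrite i≡0     = ≤-refl
  arc-pos-< (step j≡1+i) rewrite j≡1+i   = ≤-refl
  arc-pos-< (last {u} {v} {i} {e} _)     = <-≤-trans (+-monoˡ-< (rank u * 3) (offset<3 u v i))
    (*-monoˡ-≤ 3 {suc (rank u)} {rank v} (recompute (_ ≤? _) (⋖⇒rank< e)))

  ⋖-target-≤ : ∀ {u v : Word d} → .(u ⋖ v) → ∀ w → rank u < rank w → rank v ≤ rank w
  ⋖-target-≤ e w u<w = recompute (_ ≤? _) (⋖-covers e w u<w)

  mid-≡ : ∀ {u u′ v v′} .{e : u ⋖ v} .{e′ : u′ ⋖ v′} {i j} → rank u ≡ rank u′ → toℕ i ≡ toℕ j →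
          PathVertex.mid {d} u v e i ≡ mid u′ v′ e′ j
  mid-≡ {u} {u′} {v} {v′} {e} {e′} ru≡ru′ i≡j
    with refl ← rank-injective {u = u} {u′} ru≡ru′
    with refl ← ⋖-unique-target {u} {v} {v′} e e′
    with refl ← Fin.toℕ-injective i≡j = refl

  pos-word≢mid : ∀ (w u v : Word d) (i : Fin (subdivisions u v)) → rank w * 3 ≢ suc (toℕ i) + rank u * 3
  pos-word≢mid w u v i eq =
    <⇒≱ (≤-<-trans (*-monoˡ-≤ 3 {rank w} {rank u} (block-≤ (offset<3 u v i) (≤-reflexive eq)))
                (s≤s (m≤n+m _ (toℕ i))))
        (≤-reflexive (sym eq))

  pos-injective : ∀ {x y} → pos x ≡ pos y → x ≡ y
  pos-injective {word u} {word v} eq = cong word (rank-injective (*-cancelʳ-≡ (rank u) (rank v) 3 eq))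
  pos-injective {word w} {mid u v _ i} eq = contradiction eq (pos-word≢mid w u v i)
  pos-injective {mid u v _ i} {word w} eq = contradiction (sym eq) (pos-word≢mid w u v i)
  pos-injective {mid u v e i} {mid u′ v′ e′ j} eq =
    mid-≡ ru≡ru′ (suc-injective (+-cancelʳ-≡ (rank u * 3) _ _
      (trans eq (cong (λ r → suc (toℕ j) + r * 3) (sym ru≡ru′)))))
    where
    ru≡ru′ : rank u ≡ rank u′
    ru≡ru′ = ≤-antisym
      (block-≤ (offset<3 u′ v′ j) (≤-trans (m≤n+m _ (suc (toℕ i))) (≤-reflexive eq)))
      (block-≤ (offset<3 u v i) (≤-trans (m≤n+m _ (suc (toℕ j))) (≤-reflexive (sym eq))))

  -- The case that matters is an arc into a word `v`: a vertex beyond its source belongs either to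
  -- the block of a word from `v` on, or to the same edge, where no further index is left.
  arc-tight : ∀ {x y} → PathArc x y → ∀ z → pos x < pos z → pos y ≤ pos z
  arc-tight (first i≡0)  z x<z rewrite i≡0   = x<z
  arc-tight (step j≡1+i) z x<z rewrite j≡1+i = x<z
  arc-tight (last {u} {v} {i} {e} _) (word w) x<z =
    *-monoˡ-≤ 3 (⋖-target-≤ e w (*-cancelʳ-< 3 (rank u) (rank w)
      (≤-<-trans (m≤n+m _ (suc (toℕ i))) x<z)))
  arc-tight (last {u} {v} {i} {e} 1+i≡n) (mid w w′ e′ j) x<z
    with m≤n⇒m<n∨m≡n (block-≤ {m = rank u} (offset<3 w w′ j)
           (≤-trans (m≤n+m _ (suc (toℕ i))) (<⇒≤ x<z)))
  ... | inj₁ u<w = ≤-trans (*-monoˡ-≤ 3 (⋖-target-≤ e w u<w)) (m≤n+m _ (suc (toℕ j)))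
  ... | inj₂ u≡w
    with refl ← rank-injective {u = u} {w} u≡w
    with refl ← ⋖-unique-target {u} {v} {w′} e e′ =
      contradiction (subst (_≤ toℕ j) 1+i≡n (≤-pred (+-cancelʳ-< (rank u * 3) _ _ x<z)))
                    (<⇒≱ (Fin.toℕ<n j))

  arc-unique-source : ∀ {x y z} → PathArc x z → PathArc y z → x ≡ y
  arc-unique-source {x} {y} xz yz = pos-injective (≤-antisym
    (≮⇒≥ λ y<x → <⇒≱ (arc-pos-< xz) (arc-tight yz x y<x))
    (≮⇒≥ λ x<y → <⇒≱ (arc-pos-< yz) (arc-tight xz y x<y)))

  arc-unique-target : ∀ {x y z} → PathArc x y → PathArc x z → y ≡ z
  arc-unique-target {x} {y} {z} xy xz = pos-injective (≤-antisym
    (arc-tight xy z (arc-pos-< xz)) (arc-tight xz y (arc-pos-< xy)))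

  -- Walks in the path

  adjacent-stays-below : ∀ {x y} w → PathAdj x y → y ≢ word w → pos x < rank w * 3 → pos y < rank w * 3
  adjacent-stays-below w (fwd xy) y≢w x<w = ≤∧≢⇒< (arc-tight xy (word w) x<w) (y≢w ∘ pos-injective)
  adjacent-stays-below w (bwd yx) _   x<w = <-trans (arc-pos-< yx) x<w

  Walk : ℕ → (ℕ → PathVertex d) → Set
  Walk L h = ∀ i → i < L → PathAdj (h i) (h (suc i))

  walk-colour : ∀ {L h} → Walk L h → pathColour (h L) ≡ alternate L (pathColour (h 0))
  walk-colour {zero}  _    = refl
  walk-colour {suc L} walk = trans (adjacent-colour (walk L ≤-refl))
    (cong not (walk-colour (λ i i<L → walk i (<-trans i<L ≤-refl))))

  walk-side : ∀ {L h} w → Walk L h → (∀ i → i ≤ L → h i ≢ word w) →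
              (pos (h 0) < rank w * 3 → pos (h L) < rank w * 3) ×
              (pos (h L) < rank w * 3 → pos (h 0) < rank w * 3)
  walk-side {zero}  w _ _ = (λ lt → lt) , (λ lt → lt)
  walk-side {suc L} w walk avoids =
    let there , back = walk-side w (λ i i<L → walk i (<-trans i<L ≤-refl))
                                  (λ i i≤L → avoids i (≤-trans i≤L (n≤1+n L)))
    in adjacent-stays-below w (walk L ≤-refl) (avoids (suc L) ≤-refl) ∘ there
     , back ∘ adjacent-stays-below w (symmetric PathArc (walk L ≤-refl)) (avoids L (n≤1+n L))

  -- A walk in the path meets every word between its ends.
  walk⇒Unseparated : ∀ {L h u v} → Walk L h → h 0 ≡ word u → h L ≡ word v →
                     (∀ i w → i ≤ L → h i ≡ word w → level w ≡ level u ⊎ level w ≡ level v →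
                              w ≡ u ⊎ w ≡ v) →
                     Unseparated u v
  walk⇒Unseparated {L} {h} {u} {v} walk h0≡u hL≡v ends w lvl w≢u w≢v =
    (λ u<w → side h0≡u hL≡v (proj₁ sides) u<w) , (λ v<w → side hL≡v h0≡u (proj₂ sides) v<w)
    where
    avoids : ∀ i → i ≤ L → h i ≢ word w
    avoids i i≤L hi≡w with ends i w i≤L hi≡w lvl
    ... | inj₁ w≡u = w≢u w≡u
    ... | inj₂ w≡v = w≢v w≡v

    sides = walk-side w walk avoids

    side : ∀ {x y a b} → x ≡ word a → y ≡ word b →
           (pos x < rank w * 3 → pos y < rank w * 3) → rank a < rank w → rank b < rank w
    side {a = a} {b} refl refl f a<w = *-cancelʳ-< 3 (rank b) (rank w) (f (*-monoˡ-< 3 a<w))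

-- Triangles and diamonds

module _ {d : ℕ} where

  path-adjacent : ∀ {x y : PathVertex d} → Adj (G d) (path x) (path y) → PathAdj x y
  path-adjacent (fwd (path xy)) = fwd xy
  path-adjacent (bwd (path yx)) = bwd yx

  spoke-adjacent : ∀ {i} {x : PathVertex d} → Adj (G d) (hub i) (path x) →
                   Σ[ w ∈ Word d ] x ≡ word w × level w ≡ i
  spoke-adjacent (fwd (spoke a)) = _ , refl , refl

  adjacent-spoke : ∀ {i} (w : Word d) → level w ≡ i → Adj (G d) (hub i) (path (word w))
  adjacent-spoke (_ , a) refl = fwd (spoke a)

  word-words-nonadjacent : ∀ {u v : Word d} → ¬ Adj (G d) (path (word u)) (path (word v))
  word-words-nonadjacent (fwd (path ()))
  word-words-nonadjacent (bwd (path ()))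

  adj-sym : ∀ {x y} → Adj (G d) x y → Adj (G d) y x
  adj-sym = Graph.sym-Adj (G d)

  adj-irrefl : ∀ {x} → ¬ Adj (G d) x x
  adj-irrefl = Graph.irrefl-Adj (G d) refl

  adj-substˡ : ∀ {x x′ y} → x ≡ x′ → Adj (G d) x y → Adj (G d) x′ y
  adj-substˡ refl adj = adj

  adj-substʳ : ∀ {x y y′} → y ≡ y′ → Adj (G d) x y → Adj (G d) x y′
  adj-substʳ refl adj = adj

  -- A word has a single level and so sees a single hub; two words are never adjacent, since every
  -- edge is subdivided; three path vertices are excluded by the 2-colouring.
  path-in-no-triangle : ∀ {x y z} → Adj (G d) (path x) y → Adj (G d) (path x) z → ¬ Adj (G d) y z
  path-in-no-triangle {y = hub j} {hub k} xj xk jk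
    with _ , refl , refl ← spoke-adjacent (adj-sym xj)
    with _ , refl , refl ← spoke-adjacent (adj-sym xk) = adj-irrefl jk
  path-in-no-triangle {y = hub j} {path z} xj xz jz
    with _ , refl , _ ← spoke-adjacent (adj-sym xj)
    with _ , refl , _ ← spoke-adjacent jz = word-words-nonadjacent xz
  path-in-no-triangle {y = path y} {hub k} xy xk yk
    with _ , refl , _ ← spoke-adjacent (adj-sym xk)
    with _ , refl , _ ← spoke-adjacent (adj-sym yk) = word-words-nonadjacent xy
  path-in-no-triangle {y = path y} {path z} xy xz yz =
    Bool.not-¬ (trans (adjacent-colour (path-adjacent xz)) (sym (adjacent-colour (path-adjacent xy))))
               (adjacent-colour (path-adjacent yz))

  module _ {X : Vertex (G d) → Set} {H : Graph} (iso : induced (G d) X ≅ H) where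
    open _≅_ iso

    private
      preimage : Vertex H → Refinement (GVertex d) X
      preimage = Inverse.from bijection

    embed : Vertex H → GVertex d
    embed = value ∘ preimage

    embed-injective : ∀ {x y} → embed x ≡ embed y → x ≡ y
    embed-injective {x} {y} eq =
      trans (sym (Inverse.strictlyInverseˡ bijection x))
            (trans (cong (Inverse.to bijection) (value-injective eq))
                   (Inverse.strictlyInverseˡ bijection y))
      where
      value-injective : ∀ {u v : Refinement (GVertex d) X} → value u ≡ value v → u ≡ v
      value-injective {_ , irr _} {_ , irr _} refl = refl

    embed-adjacent : ∀ {x y} → Adj H x y → Adj (G d) (embed x) (embed y)
    embed-adjacent {x} {y} xy = Equivalence.from (adjacency (preimage x) (preimage y))
      (subst₂ (Adj H) (sym (Inverse.strictlyInverseˡ bijection x))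
                      (sym (Inverse.strictlyInverseˡ bijection y)) xy)

    embed-reflects : ∀ {x y} → Adj (G d) (embed x) (embed y) → Adj H x y
    embed-reflects {x} {y} xy =
      subst₂ (Adj H) (Inverse.strictlyInverseˡ bijection x) (Inverse.strictlyInverseˡ bijection y)
        (Equivalence.to (adjacency (preimage x) (preimage y)) xy)

    triangle-avoids-path : ∀ a b c {x} → embed a ≡ path x →
                           Adj H a b → Adj H a c → Adj H b c → ⊥
    triangle-avoids-path _ _ _ ea≡x ab ac bc = path-in-no-triangle
      (adj-substˡ ea≡x (embed-adjacent ab))
      (adj-substˡ ea≡x (embed-adjacent ac))
      (embed-adjacent bc)

  hub⊎path : ∀ (x : GVertex d) → (∃[ i ] x ≡ hub i) ⊎ (∃[ y ] x ≡ path y)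
  hub⊎path (hub i)  = inj₁ (i , refl)
  hub⊎path (path y) = inj₂ (y , refl)

  -- Each of the two non-adjacent vertices forms a triangle with the other two vertices, so both are
  -- hubs; but distinct hubs are adjacent.
  diamond-free : ∀ (X : Vertex (G d) → Set) → ¬ (induced (G d) X ≅ diamond)
  diamond-free X iso with hub⊎path (embed iso 0F) | hub⊎path (embed iso 1F)
  ... | inj₂ (_ , e0≡x) | _ = triangle-avoids-path iso 0F 2F 3F e0≡x
        ((λ ()) , λ { (inj₁ (_ , ())) ; (inj₂ (() , _)) })
        ((λ ()) , λ { (inj₁ (_ , ())) ; (inj₂ (() , _)) })
        ((λ ()) , λ { (inj₁ (() , _)) ; (inj₂ (() , _)) })
  ... | inj₁ _ | inj₂ (_ , e1≡x) = triangle-avoids-path iso 1F 2F 3F e1≡x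
        ((λ ()) , λ { (inj₁ (() , _)) ; (inj₂ (_ , ())) })
        ((λ ()) , λ { (inj₁ (() , _)) ; (inj₂ (_ , ())) })
        ((λ ()) , λ { (inj₁ (() , _)) ; (inj₂ (() , _)) })
  ... | inj₁ (i , e0≡i) | inj₁ (j , e1≡j) =
    proj₂ (embed-reflects iso {0F} {1F} (subst₂ (Adj (G d)) (sym e0≡i) (sym e1≡j) (fwd (hubs i≢j))))
          (inj₁ (refl , refl))
    where
    i≢j : i ≢ j
    i≢j i≡j with () ← embed-injective iso {0F} {1F} (trans e0≡i (trans (cong hub i≡j) (sym e1≡j)))

  -- Indexing the cycle by all of ℕ, with period `n`, allows it to be read from any vertex without
  -- modular arithmetic.
  record IsHole (n : ℕ) (g : ℕ → GVertex d) : Set where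
    field
      consecutive : ∀ i → Adj (G d) (g i) (g (suc i))
      periodic    : ∀ i → g (n + i) ≡ g i
      chordless   : ∀ k i → k < n → Adj (G d) (g i) (g (k + i)) → k ≡ 1 ⊎ suc k ≡ n
      distinct    : ∀ k i → 0 < k → k < n → g (k + i) ≢ g i

  -- The value at a hub is arbitrary.
  toPath : GVertex d → PathVertex d
  toPath (hub i)  = word (i , replicate (toℕ i) one , one)
  toPath (path x) = x

  -- Closed walks and holes of even length

  module Orientation
    (R _⊏_ : PathVertex d → PathVertex d → Set) (h : ℕ → PathVertex d)
    (R-unique-source : ∀ {x y z} → R x z → R y z → x ≡ y)
    (R⇒⊏ : ∀ {x y} → R x y → x ⊏ y) (⊏-trans : ∀ {x y z} → x ⊏ y → y ⊏ z → x ⊏ z)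
    (no-backtrack : ∀ i → h (2 + i) ≢ h i)
    (walk : ∀ i → R (h i) (h (suc i)) ⊎ R (h (suc i)) (h i))
    (start : R (h 0) (h 1)) where

    -- If the direction changed, two consecutive arcs would point at the same vertex and so have the
    -- same source, which is a backtrack. `R` is kept abstract so that the argument serves both
    -- directions of the path.
    propagates : ∀ i → R (h i) (h (suc i))
    propagates zero = start
    propagates (suc i) with walk (suc i)
    ... | inj₁ onward = onward
    ... | inj₂ back   = contradiction (R-unique-source back (propagates i)) (no-backtrack i)

    progress : ∀ i → h 0 ⊏ h (suc i)
    progress zero    = R⇒⊏ start
    progress (suc i) = ⊏-trans (progress i) (R⇒⊏ (propagates (suc i)))

  module EvenHole {q : ℕ} {g : ℕ → GVertex d} (isHole : IsHole (4 + q * 2) g) where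
    open IsHole isHole

    IsPath : GVertex d → Set
    IsPath x = ∃[ y ] x ≡ path y

    toPath-path : ∀ {x} → IsPath x → x ≡ path (toPath x)
    toPath-path (_ , refl) = refl

    path-consecutive : ∀ i → IsPath (g i) → IsPath (g (suc i)) →
                       PathAdj (toPath (g i)) (toPath (g (suc i)))
    path-consecutive i here there = path-adjacent
      (subst₂ (Adj (G d)) (toPath-path here) (toPath-path there) (consecutive i))

    reindex : ∀ {x k l} → k ≡ l → Adj (G d) x (g k) → Adj (G d) x (g l)
    reindex refl adj = adj

    -- The part of the hole on the path, with `i` and `j` the hubs next to its ends; they coincide
    -- if the hole has one hub. No inner vertex sees either hub, so the end words are unseparated,
    -- while `L` fixes how their colours compare.
    module Segment {a L i j} (onPath : ∀ k → k ≤ L → IsPath (g (k + a)))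
                   (hub-i : Adj (G d) (hub i) (g a)) (hub-j : Adj (G d) (hub j) (g (L + a)))
                   (only-i : ∀ k → k ≤ L → Adj (G d) (hub i) (g (k + a)) → k ≡ 0 ⊎ k ≡ L)
                   (only-j : ∀ k → k ≤ L → Adj (G d) (hub j) (g (k + a)) → k ≡ 0 ⊎ k ≡ L) where

      h : ℕ → PathVertex d
      h k = toPath (g (k + a))

      h-path : ∀ k → k ≤ L → g (k + a) ≡ path (h k)
      h-path k k≤L = toPath-path (onPath k k≤L)

      walk : Walk L h
      walk k k<L = path-consecutive (k + a) (onPath k (<⇒≤ k<L)) (onPath (suc k) k<L)

      end : ∀ {i} k → k ≤ L → Adj (G d) (hub i) (g (k + a)) → Σ[ w ∈ Word d ] h k ≡ word w × level w ≡ i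
      end k k≤L adj = spoke-adjacent (adj-substʳ (h-path k k≤L) adj)

      u v : Word d
      u = proj₁ (end 0 z≤n hub-i)
      v = proj₁ (end L ≤-refl hub-j)

      h0≡u : h 0 ≡ word u
      h0≡u = proj₁ (proj₂ (end 0 z≤n hub-i))

      hL≡v : h L ≡ word v
      hL≡v = proj₁ (proj₂ (end L ≤-refl hub-j))

      level-u : level u ≡ i
      level-u = proj₂ (proj₂ (end 0 z≤n hub-i))

      level-v : level v ≡ j
      level-v = proj₂ (proj₂ (end L ≤-refl hub-j))

      word-injective : ∀ {u v : Word d} → PathVertex.word u ≡ word v → u ≡ v
      word-injective refl = refl

      unseparated : Unseparated u v
      unseparated = walk⇒Unseparated walk h0≡u hL≡v meets-ends
        where
        spoke-to : ∀ {i} k w → k ≤ L → h k ≡ word w → level w ≡ i → Adj (G d) (hub i) (g (k + a))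
        spoke-to k w k≤L hk≡w lvl =
          adj-substʳ (sym (trans (h-path k k≤L) (cong path hk≡w))) (adjacent-spoke w lvl)

        at-end : ∀ {k w} → h k ≡ word w → k ≡ 0 ⊎ k ≡ L → w ≡ u ⊎ w ≡ v
        at-end hk≡w (inj₁ refl) = inj₁ (word-injective (trans (sym hk≡w) h0≡u))
        at-end hk≡w (inj₂ refl) = inj₂ (word-injective (trans (sym hk≡w) hL≡v))

        meets-ends : ∀ k w → k ≤ L → h k ≡ word w → level w ≡ level u ⊎ level w ≡ level v → w ≡ u ⊎ w ≡ v
        meets-ends k w k≤L hk≡w (inj₁ lvl) =
          at-end hk≡w (only-i k k≤L (spoke-to k w k≤L hk≡w (trans lvl level-u)))
        meets-ends k w k≤L hk≡w (inj₂ lvl) =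
          at-end hk≡w (only-j k k≤L (spoke-to k w k≤L hk≡w (trans lvl level-v)))

      colour-v : colour v ≡ alternate L (colour u)
      colour-v = subst₂ (λ x y → pathColour y ≡ alternate L (pathColour x)) h0≡u hL≡v (walk-colour walk)

    alternate-even : ∀ q b → alternate (q * 2) b ≡ b
    alternate-even zero    b = refl
    alternate-even (suc q) b = trans (Bool.not-involutive _) (alternate-even q b)

    -- A walk in the path without backtracking keeps its direction, so its position changes strictly
    -- and it cannot close up.
    some-hub : ¬ (∀ i → IsPath (g i))
    some-hub onPath = [ forwards , backwards ]′ (orient 0)
      where
      h : ℕ → PathVertex d
      h i = toPath (g i)

      h-closed : pos (h (4 + q * 2 + 0)) ≡ pos (h 0)
      h-closed = cong (pos ∘ toPath) (periodic 0)

      no-backtrack : ∀ i → h (2 + i) ≢ h i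
      no-backtrack i eq = distinct 2 i z<s (s<s (s<s z<s))
        (trans (toPath-path (onPath (2 + i))) (trans (cong path eq) (sym (toPath-path (onPath i)))))

      orient : ∀ i → PathArc (h i) (h (suc i)) ⊎ PathArc (h (suc i)) (h i)
      orient i with path-consecutive i (onPath i) (onPath (suc i))
      ... | fwd arc = inj₁ arc
      ... | bwd arc = inj₂ arc

      forwards : ¬ PathArc (h 0) (h 1)
      forwards start = <-irrefl (sym h-closed)
        (Orientation.progress PathArc (λ x y → pos x < pos y) h
        arc-unique-source arc-pos-< <-trans no-backtrack orient start (3 + q * 2 + 0))

      backwards : ¬ PathArc (h 1) (h 0)
      backwards start = <-irrefl h-closed
        (Orientation.progress (λ x y → PathArc y x) (λ x y → pos y < pos x) h
        arc-unique-target arc-pos-< (λ y<x z<y → <-trans z<y y<x) no-backtrack (swap ∘ orient)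
        start (3 + q * 2 + 0))

    -- The two hubs leave `2 + q * 2` path vertices joined by the odd number `1 + q * 2` of edges,
    -- so the end words differ in colour; but they are unseparated and of distinct levels.
    adjacent-hubs : ∀ {a i j} → g a ≡ hub i → g (suc a) ≡ hub j → ⊥
    adjacent-hubs {a} {i} {j} ga≡i gb≡j = Bool.not-¬ (sym same-colour)
      (trans colour-v (cong not (alternate-even q (colour u))))
      where
      n : ℕ
      n = 4 + q * 2

      from-i : ∀ k → k < n → Adj (G d) (hub i) (g (k + a)) → k ≡ 1 ⊎ suc k ≡ n
      from-i k k<n adj = chordless k a k<n (adj-substˡ (sym ga≡i) adj)

      from-j : ∀ k → k < n → Adj (G d) (hub j) (g (suc k + a)) → k ≡ 1 ⊎ suc k ≡ n
      from-j k k<n adj = chordless k (suc a) k<n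
        (subst₂ (Adj (G d)) (sym gb≡j) (cong g (sym (+-suc k a))) adj)

      i≢j : i ≢ j
      i≢j refl = adj-irrefl (subst₂ (Adj (G d)) ga≡i gb≡j (consecutive a))

      fits : ∀ k → k ≤ 1 + q * 2 → 2 + k < n
      fits k k≤L = s<s (s<s (s≤s k≤L))

      only-i : ∀ k → k ≤ 1 + q * 2 → Adj (G d) (hub i) (g (2 + k + a)) → k ≡ 1 + q * 2
      only-i k k≤L adj with from-i (2 + k) (fits k k≤L) adj
      ... | inj₂ refl = refl

      only-j : ∀ k → k ≤ 1 + q * 2 → Adj (G d) (hub j) (g (2 + k + a)) → k ≡ 0
      only-j k k≤L adj with from-j (suc k) (<-trans (n<1+n _) (fits k k≤L)) adj
      ... | inj₁ refl = refl
      ... | inj₂ refl = contradiction k≤L 1+n≰n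

      onPath : ∀ k → k ≤ 1 + q * 2 → IsPath (g (2 + k + a))
      onPath k k≤L with hub⊎path (g (2 + k + a))
      ... | inj₂ isPath = isPath
      -- A third hub would be adjacent to both `i` and `j`: the first forces it to the end of the
      -- stretch, the second to its beginning.
      ... | inj₁ (m , gk≡m) with only-i k k≤L (hub-adjacent m≢i) | only-j k k≤L (hub-adjacent m≢j)
        where
        hub-adjacent : ∀ {i} → i ≢ m → Adj (G d) (hub i) (g (2 + k + a))
        hub-adjacent i≢m = adj-substʳ (sym gk≡m) (fwd (hubs i≢m))

        m≢i : i ≢ m
        m≢i refl = distinct (2 + k) a z<s (fits k k≤L) (trans gk≡m (sym ga≡i))

        m≢j : j ≢ m
        m≢j refl = distinct (suc k) (suc a) z<s (<-trans (n<1+n _) (fits k k≤L))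
          (trans (cong g (+-suc (suc k) a)) (trans gk≡m (sym gb≡j)))
      ... | refl | ()

      hub-j : Adj (G d) (hub j) (g (2 + a))
      hub-j = adj-substˡ gb≡j (consecutive (suc a))

      hub-i : Adj (G d) (hub i) (g (3 + q * 2 + a))
      hub-i = adj-sym (adj-substʳ (trans (periodic a) ga≡i) (consecutive (3 + q * 2 + a)))

      at : ∀ k → k + (2 + a) ≡ 2 + k + a
      at k = trans (+-suc k (suc a)) (cong suc (+-suc k a))

      -- Following the hole onwards, the stretch begins next to `j` and ends next to `i`, so the two
      -- hubs appear in exchanged order.
      open Segment {2 + a} {1 + q * 2} {j} {i}
        (λ k k≤L → subst (IsPath ∘ g) (sym (at k)) (onPath k k≤L))
        hub-j (reindex (sym (at (1 + q * 2))) hub-i)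
        (λ k k≤L adj → inj₁ (only-j k k≤L (reindex (at k) adj)))
        (λ k k≤L adj → inj₂ (only-i k k≤L (reindex (at k) adj)))

      same-colour : colour u ≡ colour v
      same-colour = unseparated-distinct-levels unseparated λ lvl →
        i≢j (trans (sym level-v) (trans (sym lvl) level-u))

    -- By periodicity `g (3 + q * 2 + a)` precedes `g a`. The hub leaves `3 + q * 2` path vertices
    -- with an even number of edges, so the end words agree in colour, whereas distinct unseparated
    -- words of one level must differ.
    isolated-hub : ∀ {a i} → g a ≡ hub i → IsPath (g (suc a)) → IsPath (g (3 + q * 2 + a)) → ⊥
    isolated-hub {a} {i} ga≡i first-path last-path =
      unseparated-same-level u≢v unseparated (trans level-u (sym level-v))
        (sym (trans colour-v (alternate-even (suc q) (colour u))))
      where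
      n : ℕ
      n = 4 + q * 2

      only : ∀ k → k ≤ 2 + q * 2 → Adj (G d) (hub i) (g (suc k + a)) → k ≡ 0 ⊎ k ≡ 2 + q * 2
      only k k≤L adj
        with chordless (suc k) a (s<s (s≤s k≤L)) (adj-substˡ (sym ga≡i) adj)
      ... | inj₁ refl = inj₁ refl
      ... | inj₂ refl = inj₂ refl

      onPath : ∀ k → k ≤ 2 + q * 2 → IsPath (g (suc k + a))
      onPath k k≤L with hub⊎path (g (suc k + a))
      ... | inj₂ isPath = isPath
      ... | inj₁ (m , gk≡m) with only k k≤L (adj-substʳ (sym gk≡m) (fwd (hubs i≢m)))
        where
        i≢m : i ≢ m
        i≢m refl = distinct (suc k) a z<s (s<s (s≤s k≤L)) (trans gk≡m (sym ga≡i))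
      ...   | inj₁ refl = first-path
      ...   | inj₂ refl = last-path

      hub-first : Adj (G d) (hub i) (g (suc a))
      hub-first = adj-substˡ ga≡i (consecutive a)

      hub-last : Adj (G d) (hub i) (g (3 + q * 2 + a))
      hub-last = adj-sym (adj-substʳ (trans (periodic a) ga≡i) (consecutive (3 + q * 2 + a)))

      at : ∀ k → k + suc a ≡ suc k + a
      at k = +-suc k a

      open Segment {suc a} {2 + q * 2} {i} {i}
        (λ k k≤L → subst (IsPath ∘ g) (sym (at k)) (onPath k k≤L))
        hub-first (reindex (sym (at (2 + q * 2))) hub-last)
        (λ k k≤L adj → only k k≤L (reindex (at k) adj))
        (λ k k≤L adj → only k k≤L (reindex (at k) adj))

      u≢v : u ≢ v
      u≢v u≡v = distinct (2 + q * 2) (suc a) z<s (n≤1+n _)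
        (trans (h-path (2 + q * 2) ≤-refl) (trans
          (cong path (trans hL≡v (trans (cong word (sym u≡v)) (sym h0≡u))))
          (sym (h-path 0 z≤n))))

    hub-free : ∀ {a i} → g a ≡ hub i → ⊥
    hub-free {a} ga≡i with hub⊎path (g (suc a)) | hub⊎path (g (3 + q * 2 + a))
    ... | inj₁ (_ , gb≡j) | _               = adjacent-hubs ga≡i gb≡j
    ... | inj₂ _          | inj₁ (_ , gc≡j) = adjacent-hubs gc≡j (trans (periodic a) ga≡i)
    ... | inj₂ gb-path    | inj₂ gc-path    = isolated-hub ga≡i gb-path gc-path

    impossible : ⊥
    impossible = some-hub λ i →
      [ (λ (_ , gi≡j) → ⊥-elim (hub-free gi≡j)) , (λ isPath → isPath) ]′ (hub⊎path (g i))

-- Cycles as periodic sequences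

module _ (m : ℕ) where

  private
    n : ℕ
    n = suc m

  toℕ-mod : ∀ i → toℕ (i mod n) ≡ i % n
  toℕ-mod i = Fin.toℕ-fromℕ< (m%n<n i n)

  mod-cong : ∀ i j → i % n ≡ j % n → i mod n ≡ j mod n
  mod-cong i j eq = Fin.toℕ-injective (trans (toℕ-mod i) (trans eq (sym (toℕ-mod j))))

  mod-injective : ∀ i j → i mod n ≡ j mod n → i % n ≡ j % n
  mod-injective i j eq = trans (sym (toℕ-mod i)) (trans (cong toℕ eq) (toℕ-mod j))

  %-congʳ-+ : ∀ i j k → i % n ≡ j % n → (i + k) % n ≡ (j + k) % n
  %-congʳ-+ i j k eq = trans (%-distribˡ-+ i k n)
    (trans (cong (λ r → (r + k % n) % n) eq) (sym (%-distribˡ-+ j k n)))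

  -- Adding `i * m` completes the summand `i` to `i * n`, which vanishes modulo `n`.
  %-cancelʳ-+ : ∀ {k l} i → (k + i) % n ≡ (l + i) % n → k % n ≡ l % n
  %-cancelʳ-+ {k} {l} i eq = trans (sym (undo k)) (trans (%-congʳ-+ (k + i) (l + i) (i * m) eq) (undo l))
    where
    undo : ∀ k → (k + i + i * m) % n ≡ k % n
    undo k = trans (cong (_% n) (trans (+-assoc k i (i * m)) (cong (k +_) (sym (*-suc i m)))))
                   ([m+kn]%n≡m%n k i n)

  suc-% : ∀ i → suc (i % n) % n ≡ suc i % n
  suc-% i = subst₂ (λ x y → x % n ≡ y % n) (+-comm (i % n) 1) (+-comm i 1)
    (%-congʳ-+ (i % n) i 1 (m%n%n≡m%n i n))

  arc⇒% : ∀ {i j} → CycleArc (i mod n) (j mod n) → suc i % n ≡ j % n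
  arc⇒% {i} {j} (next j≡1+i) = sym (trans (sym (m%n%n≡m%n j n)) (trans (cong (_% n)
    (subst₂ (λ x y → y ≡ suc x) (toℕ-mod i) (toℕ-mod j) j≡1+i)) (suc-% i)))
  arc⇒% {i} {j} (wrap 1+i≡n j≡0) = trans (sym (suc-% i)) (trans
    (cong (_% n) (subst (λ x → suc x ≡ n) (toℕ-mod i) 1+i≡n))
    (trans (n%n≡0 n) (sym (trans (sym (toℕ-mod j)) j≡0))))

  %⇒arc : ∀ i → CycleArc (i mod n) (suc i mod n)
  %⇒arc i with m≤n⇒m<n∨m≡n (m%n<n i n)
  ... | inj₁ 1+i<n = next (trans (toℕ-mod (suc i)) (trans (sym (suc-% i))
          (trans (m<n⇒m%n≡m 1+i<n) (cong suc (sym (toℕ-mod i))))))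
  ... | inj₂ 1+i≡n = wrap (trans (cong suc (toℕ-mod i)) 1+i≡n)
          (trans (toℕ-mod (suc i)) (trans (sym (suc-% i)) (trans (cong (_% n) 1+i≡n) (n%n≡0 n))))

module _ {d : ℕ} where

  cycle⇒IsHole : ∀ {X : Vertex (G d) → Set} {m} {3≤n : 3 ≤ suc m}
                 (iso : induced (G d) X ≅ cycle (suc m) 3≤n) →
                 IsHole (suc m) (λ i → embed iso (i mod suc m))
  cycle⇒IsHole {X} {m} {3≤n} iso = record
    { consecutive = λ i → embed-adjacent iso (fwd (%⇒arc m i))
    ; periodic    = λ i → cong (embed iso) (mod-cong m (n + i) i
                      (trans (cong (_% n) (+-comm n i)) ([m+n]%n≡m%n i n)))
    ; chordless   = λ k i k<n adj → chord k i k<n (embed-reflects iso adj)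
    ; distinct    = λ k i 0<k k<n eq → <⇒≢ 0<k (sym (trans (sym (m<n⇒m%n≡m k<n))
                      (%-cancelʳ-+ m {k} {0} i (mod-injective m (k + i) i (embed-injective iso eq)))))
    }
    where
    n : ℕ
    n = suc m

    chord : ∀ k i → k < n → SymClosure CycleArc (i mod n) ((k + i) mod n) → k ≡ 1 ⊎ suc k ≡ n
    chord k i k<n (fwd arc) = inj₁ (trans (sym (m<n⇒m%n≡m k<n))
      (trans (%-cancelʳ-+ m {k} {1} i (sym (arc⇒% m {i} {k + i} arc)))
      (m<n⇒m%n≡m {n = n} (≤-trans (s≤s (s≤s z≤n)) 3≤n))))
    chord k i k<n (bwd arc) with m≤n⇒m<n∨m≡n k<n
    ... | inj₂ 1+k≡n = inj₂ 1+k≡n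
    ... | inj₁ 1+k<n
      with () ← trans (sym (m<n⇒m%n≡m 1+k<n))
                      (%-cancelʳ-+ m {suc k} {0} i (arc⇒% m {k + i} {i} arc))

  even-hole-free : ∀ (X : Vertex (G d) → Set) → ¬ IsEvenHole (induced (G d) X)
  even-hole-free X (_ , s≤s (s≤s ()) , divides 1 refl , _)
  even-hole-free X (_ , 4≤n , divides (suc (suc q)) refl , iso) =
    EvenHole.impossible {q = q} (cycle⇒IsHole {3≤n = ≤-trans (n≤1+n 3) 4≤n} iso)

-- Search through words and directed walks along the path

anyInner? : ∀ {P : InnerLetter → Set} → Decidable P → Dec (∃ P)
anyInner? P? = map′
  (λ { (inj₁ p) → one , p ; (inj₂ p) → three , p })
  (λ { (one , p) → inj₁ p ; (three , p) → inj₂ p })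
  (P? one ⊎-dec P? three)

anyLetter? : ∀ {P : Letter → Set} → Decidable P → Dec (∃ P)
anyLetter? P? = map′
  (λ { (inj₁ (c , p)) → inner c , p ; (inj₂ (c , p)) → innerSucc c , p })
  (λ { (one , p) → inj₁ (one , p) ; (two , p) → inj₂ (one , p)
     ; (three , p) → inj₁ (three , p) ; (four , p) → inj₂ (three , p) })
  (anyInner? (P? ∘ inner) ⊎-dec anyInner? (P? ∘ innerSucc))

anyVec? : ∀ {n} {P : Vec InnerLetter n → Set} → Decidable P → Dec (∃ P)
anyVec? {zero}  P? = map′ ([] ,_) (λ { ([] , p) → p }) (P? [])
anyVec? {suc n} P? = map′ (λ (c , as , p) → c ∷ as , p) (λ { (c ∷ as , p) → c , as , p })
  (anyInner? λ c → anyVec? λ as → P? (c ∷ as))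

anyWord? : ∀ {d} {P : Word d → Set} → Decidable P → Dec (∃ P)
anyWord? P? = map′ (λ (i , as , a , p) → (i , as , a) , p) (λ ((i , as , a) , p) → i , as , a , p)
  (Fin.any? λ i → anyVec? λ as → anyLetter? λ a → P? (i , as , a))

module _ {d : ℕ} where

  _⇝_ : PathVertex d → PathVertex d → Set
  _⇝_ = Star PathArc

  ⇝-pos : ∀ {x y} → x ⇝ y → pos x ≤ pos y
  ⇝-pos ε           = ≤-refl
  ⇝-pos (arc ◅ arcs) = ≤-trans (<⇒≤ (arc-pos-< arc)) (⇝-pos arcs)

  word⇝mid : ∀ {u v} .(e : u ⋖ v) k (i : Fin (subdivisions u v)) → toℕ i ≡ k → word u ⇝ mid u v e i
  word⇝mid e zero    i i≡k = first i≡k ◅ ε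
  word⇝mid {u} {v} e (suc k) i i≡k = word⇝mid e k j (Fin.toℕ-fromℕ< k<n)
      ◅◅ step (trans i≡k (cong suc (sym (Fin.toℕ-fromℕ< k<n)))) ◅ ε
    where
    k<n : k < subdivisions u v
    k<n = <-trans (≤-reflexive (sym i≡k)) (Fin.toℕ<n i)
    j : Fin (subdivisions u v)
    j = fromℕ< k<n

  mid⇝word : ∀ {u v} .(e : u ⋖ v) k (i : Fin (subdivisions u v)) → k + suc (toℕ i) ≡ subdivisions u v →
             mid u v e i ⇝ word v
  mid⇝word e zero    i 1+i≡n = last 1+i≡n ◅ ε
  mid⇝word {u} {v} e (suc k) i eq = step (Fin.toℕ-fromℕ< 1+i<n) ◅
      mid⇝word e k j (trans (cong (λ m → k + suc m) (Fin.toℕ-fromℕ< 1+i<n)) (trans (+-suc k _) eq))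
    where
    1+i<n : suc (toℕ i) < subdivisions u v
    1+i<n = subst (suc (toℕ i) <_) eq (s≤s (m≤n+m _ k))
    j : Fin (subdivisions u v)
    j = fromℕ< 1+i<n

  from-floor : ∀ y → Σ[ u ∈ Word d ] word u ⇝ y
  from-floor (word u)      = u , ε
  from-floor (mid u v e i) = u , word⇝mid e _ i refl

  to-ceiling : ∀ y → Σ[ v ∈ Word d ] y ⇝ word v
  to-ceiling (word v)      = v , ε
  to-ceiling (mid u v e i) = v , mid⇝word e _ i (m∸n+n≡m (Fin.toℕ<n i))

  ⋖⇒⇝ : ∀ {u v} → u ⋖ v → word u ⇝ word v
  ⋖⇒⇝ {u} {v} e = word⇝mid e 0 i (Fin.toℕ-fromℕ< 0<n) ◅◅ proj₂ (to-ceiling (mid u v e i))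
    where
    0<n = proj₁ (subdivisions-bounds u v)
    i : Fin (subdivisions u v)
    i = fromℕ< 0<n

  -- The bound `m` on the difference of ranks drives the induction: a word strictly between `u` and
  -- `v` splits the walk into two with smaller difference, and if there is none, the words are
  -- consecutive.
  words-⇝ : ∀ m (u v : Word d) → rank u ≤ rank v → rank v ≤ m + rank u → word u ⇝ word v
  words-⇝ m u v u≤v v≤m+u with m≤n⇒m<n∨m≡n u≤v
  ... | inj₂ u≡v with refl ← rank-injective {u = u} {v} u≡v = ε
  words-⇝ zero    u v u≤v v≤m+u | inj₁ u<v = contradiction v≤m+u (<⇒≱ u<v)
  words-⇝ (suc m) u v u≤v v≤m+u | inj₁ u<v
    with anyWord? (λ w → (rank u <? rank w) ×-dec (rank w <? rank v))
  ... | no none = ⋖⇒⇝ (rank<⇒≺ {u = u} {v} u<v , λ w (u≺w , w≺v) →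
      none (w , ≺⇒rank< u≺w , ≺⇒rank< w≺v))
  ... | yes (w , u<w , w<v) =
    words-⇝ m u w (<⇒≤ u<w) (≤-pred (≤-trans w<v v≤m+u)) ◅◅
    words-⇝ m w v (<⇒≤ w<v) (≤-trans v≤m+u (≤-trans (≤-reflexive (sym (+-suc m (rank u)))) (+-monoʳ-≤ m u<w)))

  word-⇝ : ∀ {u v : Word d} → rank u ≤ rank v → word u ⇝ word v
  word-⇝ {u} {v} u≤v = words-⇝ (rank v) u v u≤v (m≤m+n _ _)

  -- Removing a set of vertices

  module Removal (K : Vertex (G d) → Set) where

    _~_ : Rel (Vertex (G d ∖ K)) _
    _~_ = Star (Adj (G d ∖ K))

    ~-sym : ∀ {x y} → x ~ y → y ~ x
    ~-sym = Star.reverse λ {x} {y} → Graph.sym-Adj (G d ∖ K) {x} {y}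

    Avoids : ℕ → ℕ → Set
    Avoids m n = ∀ z → m ≤ pos z → pos z ≤ n → ¬ K (path z)

    ⇝⇒~ : ∀ {x y} → x ⇝ y → Avoids (pos x) (pos y) → .(x∉K : ¬ K (path x)) .(y∉K : ¬ K (path y)) →
          (path x , irr x∉K) ~ (path y , irr y∉K)
    ⇝⇒~ ε _ _ _ = ε
    ⇝⇒~ (_◅_ {j = z} arc arcs) avoids x∉K y∉K = fwd (path arc) ◅
      ⇝⇒~ arcs (λ w z≤w → avoids w (≤-trans (<⇒≤ (arc-pos-< arc)) z≤w))
          (avoids z (<⇒≤ (arc-pos-< arc)) (⇝-pos arcs)) y∉K

    words-~ : ∀ u v → Avoids (rank u * 3) (rank v * 3) → Avoids (rank v * 3) (rank u * 3) →
              .(u∉K : ¬ K (path (word u))) .(v∉K : ¬ K (path (word v))) →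
              (path (word u) , irr u∉K) ~ (path (word v) , irr v∉K)
    words-~ u v avoids avoids′ u∉K v∉K with ≤-total (rank u) (rank v)
    ... | inj₁ u≤v = ⇝⇒~ (word-⇝ u≤v) avoids u∉K v∉K
    ... | inj₂ v≤u = ~-sym (⇝⇒~ (word-⇝ v≤u) avoids′ v∉K u∉K)

    connected-via : (c : Vertex (G d ∖ K)) → (∀ x → x ~ c) → Connected (G d ∖ K)
    connected-via c to-c x y = to-c x ◅◅ ~-sym (to-c y)

    record Interval (lo hi : PathVertex d) : Set where
      field
        inside : ∀ z → K (path z) → pos lo ≤ pos z × pos z ≤ pos hi
        filled : ∀ z → pos lo ≤ pos z → pos z ≤ pos hi → K (path z)

    -- Each side of the gap is a connected piece of the path and has to contain a neighbour of the
    -- surviving hub `s`. An empty side contains none, which is why `left` and `right` receive a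
    -- vertex `z` of their side.
    interval-removal-connected : ∀ {lo hi} s → Interval lo hi → ¬ K (hub s) →
      (∀ z → pos z < pos lo → Σ[ t ∈ Word d ] level t ≡ s × rank t * 3 < pos lo) →
      (∀ z → pos hi < pos z → Σ[ t ∈ Word d ] level t ≡ s × pos hi < rank t * 3) →
      Connected (G d ∖ K)
    interval-removal-connected {lo} {hi} s interval s∉K left right =
      connected-via (hub s , irr s∉K) to-s
      where
      open Interval interval

      below : ∀ {m n} → n < pos lo → Avoids m n
      below n<lo z _ z≤b Kz = <⇒≱ (≤-<-trans z≤b n<lo) (proj₁ (inside z Kz))

      above : ∀ {m n} → pos hi < m → Avoids m n
      above hi<m z m≤z _ Kz = <⇒≱ (<-≤-trans hi<m m≤z) (proj₂ (inside z Kz))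

      spoke-~ : ∀ t → level t ≡ s → .(t∉K : ¬ K (path (word t))) →
                (path (word t) , irr t∉K) ~ (hub s , irr s∉K)
      spoke-~ t lvl _ = adj-sym (adjacent-spoke t lvl) ◅ ε

      to-s : ∀ x → x ~ (hub s , irr s∉K)
      to-s (hub i , irr _) with i Fin.≟ s
      ... | yes refl = ε
      ... | no i≢s   = fwd (hubs i≢s) ◅ ε
      to-s (path y , irr y∉K) with pos y <? pos lo | pos hi <? pos y
      -- A vertex of the refinement carries its non-membership irrelevantly, so the contradiction
      -- has to be irrelevant too.
      ... | no y≮lo | no hi≮y = ⊥-elim-irr (y∉K (filled y (≮⇒≥ y≮lo) (≮⇒≥ hi≮y)))
      ... | yes y<lo | _ =
        let t , lvl , t<lo = left y y<lo
            u , u⇝y = from-floor y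
            u<lo = ≤-<-trans (⇝-pos u⇝y) y<lo
            u∉K = below {0} u<lo (word u) z≤n ≤-refl
            t∉K = below {0} t<lo (word t) z≤n ≤-refl
        in ~-sym (⇝⇒~ u⇝y (below y<lo) u∉K y∉K)
           ◅◅ words-~ u t (below t<lo) (below u<lo) u∉K t∉K ◅◅ spoke-~ t lvl t∉K
      ... | no _ | yes hi<y =
        let t , lvl , hi<t = right y hi<y
            v , y⇝v = to-ceiling y
            hi<v = <-≤-trans hi<y (⇝-pos y⇝v)
            v∉K = above hi<v (word v) ≤-refl ≤-refl
            t∉K = above hi<t (word t) ≤-refl ≤-refl
        in ⇝⇒~ y⇝v (above hi<y) y∉K v∉K
           ◅◅ words-~ v t (above hi<v) (above hi<t) v∉K t∉K ◅◅ spoke-~ t lvl t∉K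

-- Absence of clique cutsets

module _ {d : ℕ} where

  private
    n : ℕ
    n = suc (suc d)

  word₁ word₄ word₁₁ word₃₁ : Word n
  word₁  = 0F , [] , one
  word₄  = 0F , [] , four
  word₁₁ = 1F , one ∷ [] , one
  word₃₁ = 1F , three ∷ [] , one

  word₁-least : ∀ w → rank word₁ ≤ rank w
  word₁-least w@(_ , p , a) = ≮⇒≥ λ lt → none p a (rank-reflects {u = w} {word₁} lt)
    where
    none : ∀ {k} (p : Vec InnerLetter k) a → ¬ (encode p a <ₗ [ 1 ])
    none []          one   (this (s<s ()))
    none []          two   (this (s<s ()))
    none []          three (this (s<s ()))
    none []          four  (this (s<s ()))
    none []          _     (next _ (base ()))
    none (one ∷ _)   _     (this (s<s ()))
    none (three ∷ _) _     (this (s<s ()))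
    none (_ ∷ [])    _     (next _ ())
    none (_ ∷ _ ∷ _) _     (next _ ())

  word₄-greatest : ∀ w → rank w ≤ rank word₄
  word₄-greatest w@(_ , p , a) = ≮⇒≥ λ lt → none p a (rank-reflects {u = word₄} {w} lt)
    where
    none : ∀ {k} (p : Vec InnerLetter k) a → ¬ ([ 4 ] <ₗ encode p a)
    none []          one   (this (s<s ()))
    none []          two   (this (s<s (s<s ())))
    none []          three (this (s<s (s<s (s<s ()))))
    none []          four  (this (s<s (s<s (s<s (s<s ())))))
    none []          _     (next _ (base ()))
    none (one ∷ _)   _     (this (s<s ()))
    none (three ∷ _) _     (this (s<s (s<s (s<s ()))))
    none (one ∷ _)   _     (next () _)
    none (three ∷ _) _     (next () _)

  word₁-first : ∀ z → rank word₁ * 3 ≤ pos z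
  word₁-first z = let u , u⇝z = from-floor z in ≤-trans (*-monoˡ-≤ 3 (word₁-least u)) (⇝-pos u⇝z)

  word₄-last : ∀ z → pos z ≤ rank word₄ * 3
  word₄-last z = let v , z⇝v = to-ceiling z in ≤-trans (⇝-pos z⇝v) (*-monoˡ-≤ 3 (word₄-greatest v))

  module _ (K : Vertex (G n) → Set) where
    open Removal K

    -- The path stays intact, and every remaining hub has a neighbour on it.
    pathless-removal-connected : ¬ (∃[ x ] K (path x)) → Connected (G n ∖ K)
    pathless-removal-connected none = connected-via (path (word word₁) , irr (free _)) to-word₁
      where
      free : ∀ x → ¬ K (path x)
      free x Kx = none (x , Kx)

      free′ : ∀ {a b} → Avoids a b
      free′ z _ _ = free z

      to-word₁ : ∀ x → x ~ (path (word word₁) , irr (free _))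
      to-word₁ (hub i , irr i∉K) = adjacent-spoke w refl ◅ words-~ w word₁ free′ free′ (free _) (free _)
        where
        w : Word n
        w = i , replicate (toℕ i) one , one
      to-word₁ (path y , irr y∉K) =
        let u , u⇝y = from-floor y
        in ~-sym (⇝⇒~ u⇝y free′ (free _) y∉K) ◅◅ words-~ u word₁ free′ free′ (free _) (free _)

    -- Both ends of the path, (1) and (4), are neighbours of the first hub, so each non-empty side
    -- contains one.
    first-hub-removal-connected : ∀ {lo hi} → Interval lo hi → ¬ K (hub 0F) → Connected (G n ∖ K)
    first-hub-removal-connected interval 0∉K = interval-removal-connected 0F interval 0∉K
      (λ z z<lo → word₁ , refl , ≤-<-trans (word₁-first z) z<lo)
      (λ z hi<z → word₄ , refl , <-≤-trans hi<z (word₄-last z))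

    -- For a one-letter word removed along with its hub, the second hub connects the sides: (1,1)
    -- precedes every one-letter word except (1), the first vertex of the path, and (3,1) follows
    -- every one except (4), the last.
    top-level-removal-connected : ∀ a → let x = word (0F , [] , a) in
      Interval x x → ¬ K (hub 1F) → Connected (G n ∖ K)
    top-level-removal-connected a interval 1∉K =
      interval-removal-connected 1F interval 1∉K (left a) (right a)
      where
      left : ∀ a z → pos z < rank {n} (0F , [] , a) * 3 →
             Σ[ t ∈ Word n ] level t ≡ 1F × rank t * 3 < rank {n} (0F , [] , a) * 3
      left one   z z<x = contradiction (word₁-first z) (<⇒≱ z<x)
      left two   z z<x = word₁₁ , refl , *-monoˡ-< 3 (rank-mono word₁₁ (0F , [] , two) (this (s<s z<s)))
      left three z z<x = word₁₁ , refl , *-monoˡ-< 3 (rank-mono word₁₁ (0F , [] , three) (this (s<s z<s)))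
      left four  z z<x = word₁₁ , refl , *-monoˡ-< 3 (rank-mono word₁₁ (0F , [] , four) (this (s<s z<s)))

      right : ∀ a z → rank {n} (0F , [] , a) * 3 < pos z →
              Σ[ t ∈ Word n ] level t ≡ 1F × rank {n} (0F , [] , a) * 3 < rank t * 3
      right one   z x<z = word₃₁ , refl , *-monoˡ-< 3 (rank-mono (0F , [] , one) word₃₁ (this (s<s z<s)))
      right two   z x<z = word₃₁ , refl , *-monoˡ-< 3 (rank-mono (0F , [] , two) word₃₁ (this (s<s (s<s z<s))))
      right three z x<z = word₃₁ , refl , *-monoˡ-< 3 (rank-mono (0F , [] , three) word₃₁ (next refl halt))
      right four  z x<z = contradiction (word₄-last z) (<⇒≱ x<z)

    module _ (clique : IsClique (G n) K) where

      -- Bounds a clique through a path vertex by two elements. The form `¬ (y ≢ z)` suffices, as it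
      -- is always applied to an inequality at hand.
      clique-no-triangle : ∀ {x y z} → K (path x) → K y → K z → path x ≢ y → path x ≢ z → ¬ (y ≢ z)
      clique-no-triangle {x} {y} {z} Kx Ky Kz x≢y x≢z y≢z = path-in-no-triangle
        (clique (path x) y Kx Ky x≢y) (clique (path x) z Kx Kz x≢z) (clique y z Ky Kz y≢z)

      path-≢ : ∀ {x y : PathVertex n} → pos x ≢ pos y → GVertex.path x ≢ path y
      path-≢ x≢y refl = x≢y refl

      singleton-interval : ∀ {x} → K (path x) → (∀ z → K (path z) → pos z ≡ pos x) → Interval x x
      singleton-interval {x} Kx only = record
        { inside = λ z Kz → ≤-reflexive (sym (only z Kz)) , ≤-reflexive (only z Kz)
        ; filled = λ z x≤z z≤x → subst (K ∘ path) (pos-injective (≤-antisym x≤z z≤x)) Kx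
        }

      arc-removal-connected : ∀ {x y} → PathArc x y → K (path x) → K (path y) → Connected (G n ∖ K)
      arc-removal-connected {x} {y} xy Kx Ky = first-hub-removal-connected {x} {y}
        (record { inside = inside ; filled = filled })
        (λ K0 → clique-no-triangle Kx Ky K0 x≢y (λ ()) (λ ()))
        where
        x≢y : GVertex.path x ≢ path y
        x≢y = path-≢ (<⇒≢ (arc-pos-< xy))

        inside : ∀ z → K (path z) → pos x ≤ pos z × pos z ≤ pos y
        inside z Kz with pos x ≟ pos z | pos y ≟ pos z
        ... | yes x≡z | _ = ≤-reflexive x≡z , subst (_≤ pos y) x≡z (<⇒≤ (arc-pos-< xy))
        ... | no _    | yes y≡z = subst (pos x ≤_) y≡z (<⇒≤ (arc-pos-< xy)) , ≤-reflexive (sym y≡z)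
        ... | no x≢z  | no y≢z = contradiction (path-≢ y≢z) (clique-no-triangle Kx Ky Kz x≢y (path-≢ x≢z))

        filled : ∀ z → pos x ≤ pos z → pos z ≤ pos y → K (path z)
        filled z x≤z z≤y with m≤n⇒m<n∨m≡n x≤z
        ... | inj₁ x<z = subst (K ∘ path) (pos-injective (≤-antisym (arc-tight xy z x<z) z≤y)) Ky
        ... | inj₂ x≡z = subst (K ∘ path) (pos-injective x≡z) Kx

      -- Here `K` is a word together with its own hub. If the word has at least two letters, the
      -- first hub survives; otherwise the second hub does.
      spoke-removal-connected : ∀ {k x} → K (path x) → K (hub k) → Connected (G n ∖ K)
      spoke-removal-connected {k} {x} Kx Kk
        with spoke-adjacent (clique (hub k) (path x) Kk Kx (λ ()))
      ... | w , refl , refl = by-level w (singleton-interval Kx only) other-hub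
        where
        only : ∀ z → K (path z) → pos z ≡ rank w * 3
        only z Kz with pos z ≟ rank w * 3
        ... | yes z≡w = z≡w
        ... | no z≢w  = contradiction (λ ()) (clique-no-triangle Kx Kk Kz (λ ()) (path-≢ (z≢w ∘ sym)))

        other-hub : ∀ s → level w ≢ s → ¬ K (hub s)
        other-hub s k≢s Ks = clique-no-triangle Kx Kk Ks (λ ()) (λ ()) λ { refl → k≢s refl }

        by-level : ∀ w → Interval (word w) (word w) →
                   (∀ s → level w ≢ s → ¬ K (hub s)) → Connected (G n ∖ K)
        by-level (0F , [] , a)  interval free =
          top-level-removal-connected a interval (free 1F λ ())
        by-level w@(fsuc _ , _) interval free =
          first-hub-removal-connected {word w} {word w} interval (free 0F λ ())

      -- K is not decidable, but the conclusion is negative, so that finitely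
      -- many instances of excluded middle are available.
      not-cutset : ¬ ¬ Connected (G n ∖ K)
      not-cutset disconnected = ¬¬-excluded-middle {A = ∃[ x ] K (path x)} λ
        { (no none)      → disconnected (pathless-removal-connected none)
        ; (yes (x , Kx)) → ¬¬-excluded-middle {A = ∃[ y ] K y × path x ≢ y} λ
          { (no none) → disconnected (first-hub-removal-connected {x} {x}
              (singleton-interval Kx (λ z Kz → alone none z Kz)) (λ K0 → none (hub 0F , K0 , λ ())))
          ; (yes (hub k , Kk , _)) → disconnected (spoke-removal-connected Kx Kk)
          ; (yes (path y , Ky , x≢y)) → disconnected
              (edge Kx Ky (path-adjacent (clique (path x) (path y) Kx Ky x≢y)))
          }
        }
        where
        alone : ∀ {x} → ¬ (∃[ y ] K y × path x ≢ y) → ∀ z → K (path z) → pos z ≡ pos x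
        alone {x} none z Kz with pos x ≟ pos z
        ... | yes x≡z = sym x≡z
        ... | no x≢z  = contradiction (path z , Kz , path-≢ x≢z) none

        edge : ∀ {x y} → K (path x) → K (path y) → PathAdj x y → Connected (G n ∖ K)
        edge Kx Ky (fwd xy) = arc-removal-connected xy Kx Ky
        edge Kx Ky (bwd yx) = arc-removal-connected yx Ky Kx

theorem10 : (∀ (d : ℕ) → 1 ≤ d → DiamondEvenHoleFree (G d)) × (∀ (d : ℕ) → 2 ≤ d → ¬ HasCliqueCutset (G d))
theorem10 =
  (λ d _ X → diamond-free X , even-hole-free X) ,
  (λ { (suc (suc d)) _ (K , clique , disconnected) → not-cutset K clique disconnected
     ; (suc zero) (s≤s ()) })
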